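{- Let $q$ be an odd prime power, $d\ge2$, $Q$ a nondegenerate quadratic form on $\mathbb F_q^d$. Let $P\subseteq\mathbb F_q^d$ be nonempty, let $\mathcal S$ be a nonempty family of distinct $Q$-spheres, let $K>0$, and let $C_1\ge1$. Suppose $$\sigma(P,\mathcal S)\ge Kq^{(d-1)/2}\sqrt{|P||\mathcal S|}\qquad\text{and}\qquad\frac{64|P|}{K^2q^{d-1}}\le|\mathcal S|\le C_1Kq^{(d-1)/2}.$$ Put $n=|P|$, $s=|\mathcal S|$, $I=I(P,\mathcal S)$, and $M=\left\lceil\frac{I}{2n}\right\rceil$. Then there are two nonconcentric spheres $S_0,S_1\in\mathcal S$, a set $P'\subseteq P\cap S_0\cap S_1$, and a subfamily $\mathcal S'\subseteq\mathcal S$ such that (1) $|P'|\ge Kq^{(d-1)/2}/(8C_1)$; (2) $d_{\mathcal S}(p)\ge M$ for every $p\in P'$; (3) every $S\in\mathcal S'$ satisfies $|P'\cap S|\ge\frac{M}{2s}|P'|$, and $$\sum_{S\in\mathcal S'}|P'\cap S|\ge\frac M2|P'|,\qquad|\mathcal S'|\ge\frac M2.$$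
   Context: For $c\in\mathbb F_q^d$, $r\in\mathbb F_q$ the $Q$-sphere is $S_Q(c,r)=\{x\in\mathbb F_q^d:Q(x-c)=r\}$; spheres are parametrized by pairs $(c,r)$ and distinct spheres means distinct parameter pairs. Two spheres are nonconcentric if their centers $c,c'$ differ. $I(P,\mathcal S)=|\{(p,S)\in P\times\mathcal S:p\in S\}|$, $\sigma(P,\mathcal S)=I(P,\mathcal S)-|P||\mathcal S|/q$, and $d_{\mathcal S}(p)=|\{S\in\mathcal S:p\in S\}|$. -}

module Defs where

open import Algebra.Structures using (IsCommutativeRing)
open import Data.Fin using (Fin)
open import Data.Fin.Properties using (nonZeroIndex; inj⇒≟)
open import Data.Integer as ℤ using (+_; +[1+_])
import Data.Integer.Properties as ℤ
import Data.Integer.Solver as ℤSolver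
open import Data.List using (List; length; filter; cartesianProduct)
open import Data.Nat as ℕ using (ℕ; zero; suc; z≤n; s≤s; NonZero)
import Data.Nat.Properties as ℕ
open import Data.Nat.Primality using (Prime)
open import Data.Nat.Solver using (module +-*-Solver)
open import Data.Product using (∃; ∃₂; _×_; _,_; proj₁; proj₂)
open import Data.Rational as ℚ using (ℚ; mkℚ; 0ℚ; 1ℚ; ½; Positive; fromℚᵘ)
import Data.Rational.Properties as ℚ
import Data.Rational.Solver as ℚSolver
import Data.Rational.Unnormalised as ℚᵘ
import Data.Rational.Unnormalised.Properties as ℚᵘ
open import Data.Sum using (inj₁; inj₂)
open import Data.Vec using (Vec; map; zipWith; replicate)
open import Function.Bundles using (_↔_; Inverse)
open import Function.Properties.Inverse using (↔⇒↣)
open import Relation.Binary.Definitions using (DecidableEquality)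
open import Relation.Binary.PropositionalEquality
  using (_≡_; _≢_; refl; sym; trans; cong; cong₂; subst)
open import Relation.Nullary using (Dec; yes; no; contradiction)

fromℕ : ℕ → ℚ
fromℕ n = + n ℚ./ 1

2*-nonZero : ∀ n .{{_ : NonZero n}} → NonZero (2 ℕ.* n)
2*-nonZero (suc _) = _

-- The real numbers, as Cauchy sequences of rationals. No quotient is formed:
-- the relations below respect equality of reals (difference tending to 0).

record ℝ : Set where
  field
    seq    : ℕ → ℚ
    cauchy : ∀ ε .{{_ : Positive ε}} →
             ∃ λ N → ∀ m n → N ℕ.≤ m → N ℕ.≤ n → ℚ.∣ seq m ℚ.- seq n ∣ ℚ.≤ ε

open ℝ public

infix 4 _≤ℝ_ _<ℝ_ _≥ℝ_
infixl 7 _*ℝ_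
infixl 7 _/ℝ_[_]

_≤ℝ_ : ℝ → ℝ → Set
x ≤ℝ y = ∀ ε .{{_ : Positive ε}} → ∃ λ N → ∀ n → N ℕ.≤ n → seq x n ℚ.≤ seq y n ℚ.+ ε

_≥ℝ_ : ℝ → ℝ → Set
x ≥ℝ y = y ≤ℝ x

_<ℝ_ : ℝ → ℝ → Set
x <ℝ y = ∃ λ δ → Positive δ × ∃ λ N → ∀ n → N ℕ.≤ n → seq x n ℚ.+ δ ℚ.≤ seq y n

private
  fromℚᵘ-mono-≤ : ∀ {x y} → x ℚᵘ.≤ y → fromℚᵘ x ℚ.≤ fromℚᵘ y
  fromℚᵘ-mono-≤ {x} {y} x≤y = ℚ.toℚᵘ-cancel-≤
    (ℚᵘ.≤-respˡ-≃ (ℚᵘ.≃-sym (ℚ.toℚᵘ-fromℚᵘ x)) (ℚᵘ.≤-respʳ-≃ (ℚᵘ.≃-sym (ℚ.toℚᵘ-fromℚᵘ y)) x≤y))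

  fromℚᵘ-homo-+ : ∀ x y → fromℚᵘ (x ℚᵘ.+ y) ≡ fromℚᵘ x ℚ.+ fromℚᵘ y
  fromℚᵘ-homo-+ x y = ℚ.toℚᵘ-injective (ℚᵘ.≃-trans (ℚ.toℚᵘ-fromℚᵘ (x ℚᵘ.+ y)) (ℚᵘ.≃-sym
    (ℚᵘ.≃-trans (ℚ.toℚᵘ-homo-+ (fromℚᵘ x) (fromℚᵘ y))
      (ℚᵘ.+-cong (ℚ.toℚᵘ-fromℚᵘ x) (ℚ.toℚᵘ-fromℚᵘ y)))))

  mkℚᵘ-≤ : ∀ a b c d → a ℕ.* suc d ℕ.≤ c ℕ.* suc b → ℚᵘ.mkℚᵘ (+ a) b ℚᵘ.≤ ℚᵘ.mkℚᵘ (+ c) d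
  mkℚᵘ-≤ a b c d h = ℚᵘ.*≤* (lift h)
    where
    lift : a ℕ.* suc d ℕ.≤ c ℕ.* suc b → + a ℤ.* + suc d ℤ.≤ + c ℤ.* + suc b
    lift h rewrite sym (ℤ.pos-* a (suc d)) | sym (ℤ.pos-* c (suc b)) = ℤ.+≤+ h

  mkℚᵘ-suc : ∀ a j → ℚᵘ.mkℚᵘ (+ suc a) j ℚᵘ.≃ ℚᵘ.mkℚᵘ (+ a) j ℚᵘ.+ ℚᵘ.mkℚᵘ (+ 1) j
  mkℚᵘ-suc a j = ℚᵘ.*≡* (lemma (+ a) (+ suc j))
    where
    open ℤSolver.+-*-Solver
    lemma : ∀ a b → (+ 1 ℤ.+ a) ℤ.* (b ℤ.* b) ≡ (a ℤ.* b ℤ.+ + 1 ℤ.* b) ℤ.* b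
    lemma = solve 2 (λ a b → (con (+ 1) :+ a) :* (b :* b)
                             := (a :* b :+ con (+ 1) :* b) :* b) refl

private
  open ℚSolver.+-*-Solver using (solve; _:+_; _:*_; _:-_; :-_; _:=_; con)
  open ℚ.≤-Reasoning

  1/⁺ : (p : ℚ) .{{_ : Positive p}} → ℚ
  1/⁺ p = (ℚ.1/ p) {{ℚ.pos⇒nonZero p}}

  *-1/⁺ : (p : ℚ) .{{_ : Positive p}} → p ℚ.* 1/⁺ p ≡ 1ℚ
  *-1/⁺ p = ℚ.*-inverseʳ p {{ℚ.pos⇒nonZero p}}

  0≤⁺ : (p : ℚ) .{{_ : Positive p}} → 0ℚ ℚ.≤ p
  0≤⁺ p = ℚ.<⇒≤ (ℚ.positive⁻¹ p)

  pos-≤ : ∀ {p q} → Positive p → p ℚ.≤ q → Positive q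
  pos-≤ {p} p>0 p≤q = ℚ.positive (ℚ.<-≤-trans (ℚ.positive⁻¹ p {{p>0}}) p≤q)

  *-mono-≤ : ∀ {p q r s} → 0ℚ ℚ.≤ r → 0ℚ ℚ.≤ q → p ℚ.≤ q → r ℚ.≤ s → p ℚ.* r ℚ.≤ q ℚ.* s
  *-mono-≤ {p} {q} {r} {s} 0≤r 0≤q p≤q r≤s = ℚ.≤-trans
    (ℚ.*-monoʳ-≤-nonNeg r {{ℚ.nonNegative 0≤r}} p≤q)
    (ℚ.*-monoˡ-≤-nonNeg q {{ℚ.nonNegative 0≤q}} r≤s)

  ∣∣-swap : ∀ p q → ℚ.∣ p ℚ.- q ∣ ≡ ℚ.∣ q ℚ.- p ∣
  ∣∣-swap p q = trans (sym (ℚ.∣-p∣≡∣p∣ (p ℚ.- q)))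
    (cong ℚ.∣_∣ (solve 2 (λ a b → :- (a :- b) := b :- a) refl p q))

  ≤+⇒-≤ : ∀ {p q ε} → p ℚ.≤ q ℚ.+ ε → p ℚ.- q ℚ.≤ ε
  ≤+⇒-≤ {p} {q} {ε} h = begin
    p ℚ.- q          ≤⟨ ℚ.+-monoˡ-≤ (ℚ.- q) h ⟩
    q ℚ.+ ε ℚ.- q    ≡⟨ solve 2 (λ a e → a :+ e :- a := e) refl q ε ⟩
    ε                ∎

  two-sided : ∀ {p q ε} → p ℚ.≤ q ℚ.+ ε → q ℚ.≤ p ℚ.+ ε → ℚ.∣ p ℚ.- q ∣ ℚ.≤ ε
  two-sided {p} {q} {ε} h₁ h₂ with ℚ.∣p∣≡p∨∣p∣≡-p (p ℚ.- q)
  ... | inj₁ e = subst (ℚ._≤ ε) (sym e) (≤+⇒-≤ h₁)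
  ... | inj₂ e = subst (ℚ._≤ ε)
    (sym (trans e (solve 2 (λ a b → :- (a :- b) := b :- a) refl p q))) (≤+⇒-≤ h₂)

  bounded : (x : ℝ) → ∃ λ B → Positive B × ∃ λ N → ∀ n → N ℕ.≤ n → ℚ.∣ seq x n ∣ ℚ.≤ B
  bounded x with cauchy x 1ℚ
  ... | N , h = B , ℚ.pos+nonNeg⇒pos 1ℚ ℚ.∣ a ∣ {{ℚ.∣-∣-nonNeg a}} , N , bound
    where
    a B : ℚ
    a = seq x N
    B = 1ℚ ℚ.+ ℚ.∣ a ∣
    bound : ∀ n → N ℕ.≤ n → ℚ.∣ seq x n ∣ ℚ.≤ B
    bound n N≤n = begin
      ℚ.∣ seq x n ∣                  ≡⟨ cong ℚ.∣_∣ (solve 2 (λ b c → b := (b :- c) :+ c) refl (seq x n) a) ⟩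
      ℚ.∣ (seq x n ℚ.- a) ℚ.+ a ∣    ≤⟨ ℚ.∣p+q∣≤∣p∣+∣q∣ (seq x n ℚ.- a) a ⟩
      ℚ.∣ seq x n ℚ.- a ∣ ℚ.+ ℚ.∣ a ∣ ≤⟨ ℚ.+-monoˡ-≤ ℚ.∣ a ∣ (h n N N≤n ℕ.≤-refl) ⟩
      B                              ∎

fromℚ : ℚ → ℝ
fromℚ p = record { seq = λ _ → p ; cauchy = λ ε → 0 , λ _ _ _ _ → begin
  ℚ.∣ p ℚ.- p ∣ ≡⟨ cong ℚ.∣_∣ (ℚ.+-inverseʳ p) ⟩
  0ℚ            ≤⟨ 0≤⁺ ε ⟩
  ε             ∎ }

private
  split-ε : ∀ ε B .{{_ : Positive ε}} → Positive B → ∃ λ e → Positive e × e ℚ.* B ≡ ½ ℚ.* ε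
  split-ε ε B B>0 = h ℚ.* v , ℚ.pos*pos⇒pos h {{ℚ.pos*pos⇒pos ½ ε}} v {{ℚ.1/pos⇒pos B {{B>0}}}} , (begin-equality
    h ℚ.* v ℚ.* B    ≡⟨ ℚ.*-assoc h v B ⟩
    h ℚ.* (v ℚ.* B)  ≡⟨ cong (h ℚ.*_) (trans (ℚ.*-comm v B) (*-1/⁺ B {{B>0}})) ⟩
    h ℚ.* 1ℚ         ≡⟨ ℚ.*-identityʳ h ⟩
    h                ∎)
    where
    h v : ℚ
    h = ½ ℚ.* ε
    v = 1/⁺ B {{B>0}}

  ½+½ : ∀ ε → ½ ℚ.* ε ℚ.+ ½ ℚ.* ε ≡ ε
  ½+½ ε = trans (sym (ℚ.*-distribʳ-+ ε ½ ½)) (ℚ.*-identityˡ ε)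

  *-close : ∀ a b c d A B e f →
            ℚ.∣ a ℚ.- c ∣ ℚ.≤ e → ℚ.∣ b ∣ ℚ.≤ B → ℚ.∣ c ∣ ℚ.≤ A → ℚ.∣ b ℚ.- d ∣ ℚ.≤ f →
            ℚ.∣ a ℚ.* b ℚ.- c ℚ.* d ∣ ℚ.≤ e ℚ.* B ℚ.+ f ℚ.* A
  *-close a b c d A B e f ac≤e b≤B c≤A bd≤f = begin
    ℚ.∣ a ℚ.* b ℚ.- c ℚ.* d ∣
      ≡⟨ cong ℚ.∣_∣ (solve 4 (λ a b c d → a :* b :- c :* d := (a :- c) :* b :+ (b :- d) :* c) refl a b c d) ⟩
    ℚ.∣ (a ℚ.- c) ℚ.* b ℚ.+ (b ℚ.- d) ℚ.* c ∣
      ≤⟨ ℚ.∣p+q∣≤∣p∣+∣q∣ ((a ℚ.- c) ℚ.* b) ((b ℚ.- d) ℚ.* c) ⟩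
    ℚ.∣ (a ℚ.- c) ℚ.* b ∣ ℚ.+ ℚ.∣ (b ℚ.- d) ℚ.* c ∣
      ≡⟨ cong₂ ℚ._+_ (ℚ.∣p*q∣≡∣p∣*∣q∣ (a ℚ.- c) b) (ℚ.∣p*q∣≡∣p∣*∣q∣ (b ℚ.- d) c) ⟩
    ℚ.∣ a ℚ.- c ∣ ℚ.* ℚ.∣ b ∣ ℚ.+ ℚ.∣ b ℚ.- d ∣ ℚ.* ℚ.∣ c ∣
      ≤⟨ ℚ.+-mono-≤
           (*-mono-≤ (ℚ.0≤∣p∣ b) (ℚ.≤-trans (ℚ.0≤∣p∣ (a ℚ.- c)) ac≤e) ac≤e b≤B)
           (*-mono-≤ (ℚ.0≤∣p∣ c) (ℚ.≤-trans (ℚ.0≤∣p∣ (b ℚ.- d)) bd≤f) bd≤f c≤A) ⟩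
    e ℚ.* B ℚ.+ f ℚ.* A ∎

  *-bound : ∀ ε a b c d A B e f →
            ℚ.∣ a ℚ.- c ∣ ℚ.≤ e → ℚ.∣ b ∣ ℚ.≤ B → ℚ.∣ c ∣ ℚ.≤ A → ℚ.∣ b ℚ.- d ∣ ℚ.≤ f →
            e ℚ.* B ≡ ½ ℚ.* ε → f ℚ.* A ≡ ½ ℚ.* ε → ℚ.∣ a ℚ.* b ℚ.- c ℚ.* d ∣ ℚ.≤ ε
  *-bound ε a b c d A B e f ac≤e b≤B c≤A bd≤f eB fA = ℚ.≤-trans
    (*-close a b c d A B e f ac≤e b≤B c≤A bd≤f)
    (ℚ.≤-reflexive (trans (cong₂ ℚ._+_ eB fA) (½+½ ε)))

_*ℝ_ : ℝ → ℝ → ℝ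
x *ℝ y = record { seq = λ n → seq x n ℚ.* seq y n ; cauchy = *-cauchy }
  where
  *-cauchy : ∀ ε .{{_ : Positive ε}} → ∃ λ N → ∀ m n → N ℕ.≤ m → N ℕ.≤ n →
             ℚ.∣ seq x m ℚ.* seq y m ℚ.- seq x n ℚ.* seq y n ∣ ℚ.≤ ε
  *-cauchy ε =
    let A , A>0 , N₁ , hA = bounded x
        B , B>0 , N₂ , hB = bounded y
        e , e>0 , eB = split-ε ε B B>0
        f , f>0 , fA = split-ε ε A A>0
        N₃ , hx = cauchy x e {{e>0}}
        N₄ , hy = cauchy y f {{f>0}}
        N = N₁ ℕ.⊔ N₂ ℕ.⊔ (N₃ ℕ.⊔ N₄)
        ≥N₁ : ∀ k → N ℕ.≤ k → N₁ ℕ.≤ k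
        ≥N₁ _ h = ℕ.m⊔n≤o⇒m≤o N₁ N₂ (ℕ.m⊔n≤o⇒m≤o (N₁ ℕ.⊔ N₂) (N₃ ℕ.⊔ N₄) h)
        ≥N₂ : ∀ k → N ℕ.≤ k → N₂ ℕ.≤ k
        ≥N₂ _ h = ℕ.m⊔n≤o⇒n≤o N₁ N₂ (ℕ.m⊔n≤o⇒m≤o (N₁ ℕ.⊔ N₂) (N₃ ℕ.⊔ N₄) h)
        ≥N₃ : ∀ k → N ℕ.≤ k → N₃ ℕ.≤ k
        ≥N₃ _ h = ℕ.m⊔n≤o⇒m≤o N₃ N₄ (ℕ.m⊔n≤o⇒n≤o (N₁ ℕ.⊔ N₂) (N₃ ℕ.⊔ N₄) h)
        ≥N₄ : ∀ k → N ℕ.≤ k → N₄ ℕ.≤ k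
        ≥N₄ _ h = ℕ.m⊔n≤o⇒n≤o N₃ N₄ (ℕ.m⊔n≤o⇒n≤o (N₁ ℕ.⊔ N₂) (N₃ ℕ.⊔ N₄) h)
    in N , λ m n N≤m N≤n → *-bound ε (seq x m) (seq y m) (seq x n) (seq y n) A B e f
         (hx m n (≥N₃ m N≤m) (≥N₃ n N≤n)) (hB m (≥N₂ m N≤m))
         (hA n (≥N₁ n N≤n)) (hy m n (≥N₄ m N≤m) (≥N₄ n N≤n)) eB fA

private
  ⊔-pos : ∀ δ p → Positive δ → Positive (δ ℚ.⊔ p)
  ⊔-pos δ p δ>0 = pos-≤ δ>0 (ℚ.p≤p⊔q δ p)

  -- 1/(δ ⊔ p), for δ > 0
  inv : ∀ δ → Positive δ → ℚ → ℚ
  inv δ δ>0 p = 1/⁺ (δ ℚ.⊔ p) {{⊔-pos δ p δ>0}}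

-- The positivity proof for x bounds the sequence below by δ > 0 from some
-- index N on; the terms before N are irrelevant, and are replaced by their
-- maximum with δ so that they can be inverted as well.

infix 8 _⁻¹[_]

_⁻¹[_] : (x : ℝ) → fromℚ 0ℚ <ℝ x → ℝ
x ⁻¹[ δ , δ>0 , N₀ , δ≤x ] = record { seq = λ n → inv δ δ>0 (seq x n) ; cauchy = inv-cauchy }
  where
  instance
    _ : Positive δ
    _ = δ>0
  ⊔-lipschitz : ∀ p q → δ ℚ.⊔ p ℚ.≤ (δ ℚ.⊔ q) ℚ.+ ℚ.∣ p ℚ.- q ∣
  ⊔-lipschitz p q = ℚ.⊔-lub
    (begin
      δ                     ≤⟨ ℚ.p≤p⊔q δ q ⟩
      δ ℚ.⊔ q               ≡⟨ ℚ.+-identityʳ (δ ℚ.⊔ q) ⟨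
      δ ℚ.⊔ q ℚ.+ 0ℚ        ≤⟨ ℚ.+-monoʳ-≤ (δ ℚ.⊔ q) (ℚ.0≤∣p∣ (p ℚ.- q)) ⟩
      δ ℚ.⊔ q ℚ.+ ℚ.∣ p ℚ.- q ∣ ∎)
    (begin
      p                     ≡⟨ solve 2 (λ a b → a := b :+ (a :- b)) refl p q ⟩
      q ℚ.+ (p ℚ.- q)       ≤⟨ ℚ.+-mono-≤ (ℚ.p≤q⊔p δ q) (p≤∣p∣ (p ℚ.- q)) ⟩
      δ ℚ.⊔ q ℚ.+ ℚ.∣ p ℚ.- q ∣ ∎)
    where
    p≤∣p∣ : ∀ r → r ℚ.≤ ℚ.∣ r ∣
    p≤∣p∣ r with ℚ.≤-total 0ℚ r
    ... | inj₁ 0≤r = ℚ.≤-reflexive (sym (ℚ.0≤p⇒∣p∣≡p 0≤r))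
    ... | inj₂ r≤0 = ℚ.≤-trans r≤0 (ℚ.0≤∣p∣ r)
  w : ℚ
  w = 1/⁺ δ
  inv≤w : ∀ p → inv δ δ>0 p ℚ.≤ w
  inv≤w p = ℚ.*-cancelˡ-≤-pos δ (begin
    δ ℚ.* i           ≤⟨ ℚ.*-monoʳ-≤-nonNeg i {{ℚ.pos⇒nonNeg i {{ℚ.1/pos⇒pos t}}}} (ℚ.p≤p⊔q δ p) ⟩
    t ℚ.* i           ≡⟨ *-1/⁺ t ⟩
    1ℚ                ≡⟨ *-1/⁺ δ ⟨
    δ ℚ.* w           ∎)
    where
    t i : ℚ
    t = δ ℚ.⊔ p
    instance
      _ : Positive t
      _ = ⊔-pos δ p δ>0
    i = inv δ δ>0 p
  0≤inv : ∀ p → 0ℚ ℚ.≤ inv δ δ>0 p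
  0≤inv p = 0≤⁺ (inv δ δ>0 p) {{ℚ.1/pos⇒pos (δ ℚ.⊔ p) {{⊔-pos δ p δ>0}}}}
  inv-lipschitz : ∀ p q → ℚ.∣ inv δ δ>0 p ℚ.- inv δ δ>0 q ∣ ℚ.≤ ℚ.∣ p ℚ.- q ∣ ℚ.* (w ℚ.* w)
  inv-lipschitz p q = begin
    ℚ.∣ i ℚ.- j ∣
      ≡⟨ cong ℚ.∣_∣ (trans
           (cong₂ ℚ._-_ (sym (trans (cong (i ℚ.*_) (*-1/⁺ t)) (ℚ.*-identityʳ i)))
                        (sym (trans (cong (j ℚ.*_) (*-1/⁺ s)) (ℚ.*-identityʳ j))))
           (solve 4 (λ s t i j → i :* (t :* j) :- j :* (s :* i) := (t :- s) :* (i :* j)) refl s t i j)) ⟩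
    ℚ.∣ (t ℚ.- s) ℚ.* (i ℚ.* j) ∣
      ≡⟨ ℚ.∣p*q∣≡∣p∣*∣q∣ (t ℚ.- s) (i ℚ.* j) ⟩
    ℚ.∣ t ℚ.- s ∣ ℚ.* ℚ.∣ i ℚ.* j ∣
      ≤⟨ *-mono-≤ (ℚ.0≤∣p∣ (i ℚ.* j)) (ℚ.0≤∣p∣ (p ℚ.- q)) ∣t-s∣ ∣ij∣ ⟩
    ℚ.∣ p ℚ.- q ∣ ℚ.* (w ℚ.* w) ∎
    where
    s t i j : ℚ
    s = δ ℚ.⊔ p
    t = δ ℚ.⊔ q
    instance
      _ : Positive s
      _ = ⊔-pos δ p δ>0
      _ : Positive t
      _ = ⊔-pos δ q δ>0
    i = inv δ δ>0 p
    j = inv δ δ>0 q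
    ∣t-s∣ : ℚ.∣ t ℚ.- s ∣ ℚ.≤ ℚ.∣ p ℚ.- q ∣
    ∣t-s∣ = two-sided
      (subst (λ z → t ℚ.≤ s ℚ.+ z) (∣∣-swap q p) (⊔-lipschitz q p)) (⊔-lipschitz p q)
    ∣ij∣ : ℚ.∣ i ℚ.* j ∣ ℚ.≤ w ℚ.* w
    ∣ij∣ = begin
      ℚ.∣ i ℚ.* j ∣           ≡⟨ ℚ.∣p*q∣≡∣p∣*∣q∣ i j ⟩
      ℚ.∣ i ∣ ℚ.* ℚ.∣ j ∣     ≡⟨ cong₂ ℚ._*_ (ℚ.0≤p⇒∣p∣≡p (0≤inv p)) (ℚ.0≤p⇒∣p∣≡p (0≤inv q)) ⟩
      i ℚ.* j                 ≤⟨ *-mono-≤ (0≤inv q) (ℚ.≤-trans (0≤inv p) (inv≤w p)) (inv≤w p) (inv≤w q) ⟩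
      w ℚ.* w                 ∎
  inv-close : ∀ ε p q → ℚ.∣ p ℚ.- q ∣ ℚ.≤ ε ℚ.* (δ ℚ.* δ) → ℚ.∣ inv δ δ>0 p ℚ.- inv δ δ>0 q ∣ ℚ.≤ ε
  inv-close ε p q pq≤ = begin
    ℚ.∣ inv δ δ>0 p ℚ.- inv δ δ>0 q ∣
      ≤⟨ inv-lipschitz p q ⟩
    ℚ.∣ p ℚ.- q ∣ ℚ.* (w ℚ.* w)
      ≤⟨ ℚ.*-monoʳ-≤-nonNeg (w ℚ.* w) {{ℚ.pos⇒nonNeg (w ℚ.* w) {{ℚ.pos*pos⇒pos w {{ℚ.1/pos⇒pos δ}} w {{ℚ.1/pos⇒pos δ}}}}}} pq≤ ⟩
    ε ℚ.* (δ ℚ.* δ) ℚ.* (w ℚ.* w)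
      ≡⟨ solve 3 (λ e d w → e :* (d :* d) :* (w :* w) := e :* ((d :* w) :* (d :* w))) refl ε δ w ⟩
    ε ℚ.* ((δ ℚ.* w) ℚ.* (δ ℚ.* w))
      ≡⟨ cong (λ z → ε ℚ.* (z ℚ.* z)) (*-1/⁺ δ) ⟩
    ε ℚ.* 1ℚ
      ≡⟨ ℚ.*-identityʳ ε ⟩
    ε ∎
  inv-cauchy : ∀ ε .{{_ : Positive ε}} → ∃ λ N → ∀ m n → N ℕ.≤ m → N ℕ.≤ n →
               ℚ.∣ inv δ δ>0 (seq x m) ℚ.- inv δ δ>0 (seq x n) ∣ ℚ.≤ ε
  inv-cauchy ε =
    let N , h = cauchy x (ε ℚ.* (δ ℚ.* δ)) {{ℚ.pos*pos⇒pos ε (δ ℚ.* δ) {{ℚ.pos*pos⇒pos δ δ}}}}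
    in N , λ m n N≤m N≤n → inv-close ε (seq x m) (seq x n) (h m n N≤m N≤n)

_/ℝ_[_] : (x y : ℝ) → fromℚ 0ℚ <ℝ y → ℝ
x /ℝ y [ y>0 ] = x *ℝ y ⁻¹[ y>0 ]

-- isqrt m is the largest k with k * k ≤ m.
isqrt : ℕ → ℕ
isqrt zero    = 0
isqrt (suc m) with suc (isqrt m) ℕ.* suc (isqrt m) ℕ.≤? suc m
... | yes _ = suc (isqrt m)
... | no  _ = isqrt m

isqrt-lower : ∀ m → isqrt m ℕ.* isqrt m ℕ.≤ m
isqrt-lower zero    = z≤n
isqrt-lower (suc m) with suc (isqrt m) ℕ.* suc (isqrt m) ℕ.≤? suc m
... | yes p = p
... | no  _ = ℕ.m≤n⇒m≤1+n (isqrt-lower m)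

isqrt-upper : ∀ m → m ℕ.< suc (isqrt m) ℕ.* suc (isqrt m)
isqrt-upper zero    = s≤s z≤n
isqrt-upper (suc m) with suc (isqrt m) ℕ.* suc (isqrt m) ℕ.≤? suc m
... | yes _ = ℕ.≤-<-trans (isqrt-upper m) (ℕ.*-mono-< {suc (isqrt m)} (ℕ.n<1+n _) (ℕ.n<1+n _))
... | no ¬p = ℕ.≰⇒> ¬p

private
  sq-≤ : ∀ a b → a ℕ.* a ℕ.< b ℕ.* b → a ℕ.< b
  sq-≤ a b h with a ℕ.<? b
  ... | yes p = p
  ... | no ¬p = contradiction (ℕ.<-≤-trans h (ℕ.*-mono-≤ (ℕ.≮⇒≥ ¬p) (ℕ.≮⇒≥ ¬p))) (ℕ.<-irrefl refl)

-- √ m is the limit of ⌊(n+1)√m⌋/(n+1).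
√ : ℕ → ℝ
√ m = record { seq = approx ; cauchy = √-cauchy }
  where
  k : ℕ → ℕ
  k n = isqrt (m ℕ.* (suc n ℕ.* suc n))
  approx : ℕ → ℚ
  approx n = + k n ℚ./ suc n
  cross : ∀ i j → k i ℕ.* suc j ℕ.< suc (k j) ℕ.* suc i
  cross i j = sq-≤ (k i ℕ.* suc j) (suc (k j) ℕ.* suc i) (ℕ.≤-<-trans
    (ℕ.≤-trans (ℕ.≤-reflexive (shuffle (k i) (suc j)))
      (ℕ.≤-trans (ℕ.*-monoˡ-≤ (suc j ℕ.* suc j) (isqrt-lower (m ℕ.* (suc i ℕ.* suc i))))
        (ℕ.≤-reflexive (shuffle′ m (suc i) (suc j)))))
    (ℕ.<-≤-trans (ℕ.*-monoˡ-< (suc i ℕ.* suc i) (isqrt-upper (m ℕ.* (suc j ℕ.* suc j))))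
      (ℕ.≤-reflexive (sym (shuffle (suc (k j)) (suc i))))))
    where
    module S = +-*-Solver
    shuffle : ∀ a b → a ℕ.* b ℕ.* (a ℕ.* b) ≡ a ℕ.* a ℕ.* (b ℕ.* b)
    shuffle = S.solve 2 (λ a b → a S.:* b S.:* (a S.:* b) S.:= a S.:* a S.:* (b S.:* b)) refl
    shuffle′ : ∀ a b c → a ℕ.* (b ℕ.* b) ℕ.* (c ℕ.* c) ≡ a ℕ.* (c ℕ.* c) ℕ.* (b ℕ.* b)
    shuffle′ = S.solve 3 (λ a b c → a S.:* (b S.:* b) S.:* (c S.:* c) S.:= a S.:* (c S.:* c) S.:* (b S.:* b)) refl
  √-cauchy : ∀ ε .{{_ : Positive ε}} →
             ∃ λ N → ∀ i j → N ℕ.≤ i → N ℕ.≤ j → ℚ.∣ approx i ℚ.- approx j ∣ ℚ.≤ ε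
  √-cauchy ε@(mkℚ +[1+ e ] d _) = d , λ i j d≤i d≤j → two-sided (close i j d≤j) (close j i d≤i)
    where
    close : ∀ i j → d ℕ.≤ j → approx i ℚ.≤ approx j ℚ.+ ε
    close i j d≤j = begin
      fromℚᵘ (ℚᵘ.mkℚᵘ (+ k i) i)
        ≤⟨ fromℚᵘ-mono-≤ (mkℚᵘ-≤ (k i) i (suc (k j)) j (ℕ.<⇒≤ (cross i j))) ⟩
      fromℚᵘ (ℚᵘ.mkℚᵘ (+ suc (k j)) j)
        ≡⟨ ℚ.fromℚᵘ-cong (mkℚᵘ-suc (k j) j) ⟩
      fromℚᵘ (ℚᵘ.mkℚᵘ (+ k j) j ℚᵘ.+ ℚᵘ.mkℚᵘ (+ 1) j)
        ≡⟨ fromℚᵘ-homo-+ (ℚᵘ.mkℚᵘ (+ k j) j) (ℚᵘ.mkℚᵘ (+ 1) j) ⟩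
      fromℚᵘ (ℚᵘ.mkℚᵘ (+ k j) j) ℚ.+ fromℚᵘ (ℚᵘ.mkℚᵘ (+ 1) j)
        ≤⟨ ℚ.+-monoʳ-≤ (fromℚᵘ (ℚᵘ.mkℚᵘ (+ k j) j))
             (fromℚᵘ-mono-≤ (mkℚᵘ-≤ 1 j (suc e) d (ℕ.*-mono-≤ {1} {suc e} (s≤s z≤n) (s≤s d≤j)))) ⟩
      fromℚᵘ (ℚᵘ.mkℚᵘ (+ k j) j) ℚ.+ fromℚᵘ (ℚ.toℚᵘ ε)
        ≡⟨ cong (fromℚᵘ (ℚᵘ.mkℚᵘ (+ k j) j) ℚ.+_) (ℚ.fromℚᵘ-toℚᵘ ε) ⟩
      fromℚᵘ (ℚᵘ.mkℚᵘ (+ k j) j) ℚ.+ ε ∎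

ι : ℕ → ℝ
ι n = fromℚ (fromℕ n)

0ℝ 1ℝ : ℝ
0ℝ = fromℚ 0ℚ
1ℝ = fromℚ 1ℚ

ι-pos : ∀ n .{{_ : NonZero n}} → 0ℝ <ℝ ι n
ι-pos n@(suc _) = fromℕ n , ℚ.normalize-pos n 1 , 0 , λ _ _ → ℚ.≤-reflexive (ℚ.+-identityˡ (fromℕ n))

*ℝ-pos : ∀ x y → 0ℝ <ℝ x → 0ℝ <ℝ y → 0ℝ <ℝ x *ℝ y
*ℝ-pos x y (δ , δ>0 , N , hx) (η , η>0 , L , hy) =
  δ ℚ.* η , ℚ.pos*pos⇒pos δ η , N ℕ.⊔ L , λ n N⊔L≤n → begin
    0ℚ ℚ.+ δ ℚ.* η       ≡⟨ ℚ.+-identityˡ (δ ℚ.* η) ⟩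
    δ ℚ.* η              ≤⟨ *-mono-≤ (0≤⁺ η) (ℚ.≤-trans (0≤⁺ δ) (hx′ n N⊔L≤n)) (hx′ n N⊔L≤n) (hy′ n N⊔L≤n) ⟩
    seq x n ℚ.* seq y n  ∎
  where
  instance
    _ : Positive δ
    _ = δ>0
    _ : Positive η
    _ = η>0
  hx′ : ∀ n → N ℕ.⊔ L ℕ.≤ n → δ ℚ.≤ seq x n
  hx′ n le = subst (ℚ._≤ seq x n) (ℚ.+-identityˡ δ) (hx n (ℕ.m⊔n≤o⇒m≤o N L le))
  hy′ : ∀ n → N ℕ.⊔ L ℕ.≤ n → η ℚ.≤ seq y n
  hy′ n le = subst (ℚ._≤ seq y n) (ℚ.+-identityˡ η) (hy n (ℕ.m⊔n≤o⇒n≤o N L le))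

≥1⇒pos : ∀ x → x ≥ℝ 1ℝ → 0ℝ <ℝ x
≥1⇒pos x h =
  let N , 1≤x+½ = h ½
  in ½ , _ , N , λ n N≤n → ½≤ (seq x n) (1≤x+½ n N≤n)
  where
  ½≤ : ∀ p → 1ℚ ℚ.≤ p ℚ.+ ½ → 0ℚ ℚ.+ ½ ℚ.≤ p
  ½≤ p 1≤p+½ = begin
    1ℚ ℚ.- ½         ≤⟨ ℚ.+-monoˡ-≤ (ℚ.- ½) 1≤p+½ ⟩
    p ℚ.+ ½ ℚ.- ½    ≡⟨ ℚ.+-assoc p ½ (ℚ.- ½) ⟩
    p ℚ.+ 0ℚ         ≡⟨ ℚ.+-identityʳ p ⟩
    p                ∎

IsPrimePower : ℕ → Set
IsPrimePower q = ∃₂ λ p k → Prime p × NonZero k × q ≡ p ℕ.^ k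

record FiniteField (q : ℕ) : Set₁ where
  infix  8 -_
  infixl 7 _*_
  infixl 6 _+_ _-_
  infix  4 _≟_
  field
    Carrier           : Set
    _+_ _*_           : Carrier → Carrier → Carrier
    -_                : Carrier → Carrier
    0# 1#             : Carrier
    isCommutativeRing : IsCommutativeRing _≡_ _+_ _*_ -_ 0# 1#
    0≢1               : 0# ≢ 1#
    inverse           : ∀ x → x ≢ 0# → ∃ λ y → x * y ≡ 1#
    enumeration       : Carrier ↔ Fin q

  _-_ : Carrier → Carrier → Carrier
  x - y = x + - y

  _≟_ : DecidableEquality Carrier
  _≟_ = inj⇒≟ (↔⇒↣ enumeration)

  q-nonZero : NonZero q
  q-nonZero = nonZeroIndex (Inverse.to enumeration 0#)

module Vectors {q : ℕ} (F : FiniteField q) (d : ℕ) where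
  open FiniteField F

  infixl 6 _+ᵛ_ _-ᵛ_
  infixr 7 _·ᵛ_

  Vector : Set
  Vector = Vec Carrier d

  _+ᵛ_ _-ᵛ_ : Vector → Vector → Vector
  _+ᵛ_ = zipWith _+_
  _-ᵛ_ = zipWith _-_

  _·ᵛ_ : Carrier → Vector → Vector
  a ·ᵛ x = map (a *_) x

  0ᵛ : Vector
  0ᵛ = replicate d 0#

record QuadraticForm {q : ℕ} (F : FiniteField q) (d : ℕ) : Set where
  open FiniteField F
  open Vectors F d
  field
    form        : Vector → Carrier
    homogeneous : ∀ a x → form (a ·ᵛ x) ≡ a * a * form x

  polar : Vector → Vector → Carrier
  polar x y = form (x +ᵛ y) - form x - form y

  -- polar is symmetric, so linearity on the left makes it bilinear.
  field
    polar-+ˡ : ∀ x y z → polar (x +ᵛ y) z ≡ polar x z + polar y z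
    polar-·ˡ : ∀ a x y → polar (a ·ᵛ x) y ≡ a * polar x y

  Nondegenerate : Set
  Nondegenerate = ∀ x → (∀ y → polar x y ≡ 0#) → x ≡ 0ᵛ

-- Finite sets of points and of spheres are duplicate-free lists: the functions
-- below count with multiplicity, and give cardinalities for Unique lists.

module Spheres {q : ℕ} (F : FiniteField q) {d : ℕ} (Q : QuadraticForm F d) where
  open FiniteField F
  open Vectors F d
  open QuadraticForm Q

  Point : Set
  Point = Vector

  -- The pair (c , r) stands for the sphere { x | Q (x - c) = r }.
  Sphere : Set
  Sphere = Point × Carrier

  center : Sphere → Point
  center = proj₁

  infix 4 _∈ˢ_ _∈ˢ?_

  _∈ˢ_ : Point → Sphere → Set
  p ∈ˢ (c , r) = form (p -ᵛ c) ≡ r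

  _∈ˢ?_ : ∀ p S → Dec (p ∈ˢ S)
  p ∈ˢ? (c , r) = form (p -ᵛ c) ≟ r

  Nonconcentric : Sphere → Sphere → Set
  Nonconcentric S S′ = center S ≢ center S′

  incidences : List Point → List Sphere → ℕ
  incidences P 𝒮 = length (filter (λ (p , S) → p ∈ˢ? S) (cartesianProduct P 𝒮))

  degree : List Sphere → Point → ℕ
  degree 𝒮 p = length (filter (p ∈ˢ?_) 𝒮)

  ∣_∩_∣ : List Point → Sphere → ℕ
  ∣ P ∩ S ∣ = length (filter (_∈ˢ? S) P)

  σ : List Point → List Sphere → ℚ
  σ P 𝒮 = fromℕ (incidences P 𝒮) ℚ.- (+ (length P ℕ.* length 𝒮) ℚ./ q) {{q-nonZero}}

  q^-pos : ∀ k → 0ℝ <ℝ ι (q ℕ.^ k)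
  q^-pos k = ι-pos (q ℕ.^ k) {{ℕ.m^n≢0 q k {{q-nonZero}}}}

{-# OPTIONS --safe #-}

-- Since σ ≤ I, the first hypothesis squares to K²q^(d-1)ns ≤ I², and with the
-- lower bound on s this gives I ≥ 8n. Points of degree below M carry at most
-- half of the incidences, and each remaining point lies on at least M - 1
-- spheres not concentric to a given sphere through it. So if S₀ contains the
-- most rich points, and S₁ the most rich points of S₀ among the spheres not
-- concentric to S₀, their common rich points P′ satisfy I² ≤ 8ns²|P′|, hence
-- K²q^(d-1) ≤ 8s|P′|, and the upper bound on s gives (1). Discarding the
-- spheres that are poor on P′ again loses at most half of the incidences.

module Submission where

open import Data.Integer as ℤ using (+_; -[1+_]; +[1+_])
import Data.Integer.DivMod as ℤ
import Data.Integer.Properties as ℤ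
import Data.Integer.Solver as ℤSolver
open import Data.List using (List; []; _∷_; _++_; length; map; filter; cartesianProduct)
open import Data.List.Membership.Propositional using (_∈_)
open import Data.List.Membership.Propositional.Properties using (∈-filter⁻)
import Data.List.Properties as List
open import Data.List.Relation.Binary.Subset.Propositional using (_⊆_)
open import Data.List.Relation.Binary.Subset.Propositional.Properties using (filter-⊆)
open import Data.List.Relation.Unary.All as All using (All; []; _∷_)
import Data.List.Relation.Unary.All.Properties as All
open import Data.List.Relation.Unary.AllPairs using ([]; _∷_)
open import Data.List.Relation.Unary.Any using (here; there)
open import Data.List.Relation.Unary.Unique.Propositional using (Unique)
import Data.List.Relation.Unary.Unique.Propositional.Properties as Unique
open import Data.Nat using (ℕ; zero; suc; _+_; _∸_; _^_; _*_; _⊔_; _≤_; _<_; _≤?_; z≤n; s≤s; s≤s⁻¹; NonZero; >-nonZero)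
open import Data.Nat.Divisibility using (_∣_)
open import Data.Nat.ListAction using (sum)
open import Data.Nat.Properties
open import Algebra.Properties.CommutativeSemigroup +-commutativeSemigroup using (x∙yz≈y∙xz)
open import Data.Nat.Tactic.RingSolver using (solve-∀)
open import Data.Product using (_×_; _,_; ∃; ∃-syntax; proj₁; proj₂)
open import Data.Rational as ℚ using (ℚ; mkℚ; 0ℚ; 1ℚ; ½; Positive; _/_; ↥_; ↧_; ↧ₙ_; toℚᵘ; ceiling; floor)
import Data.Rational.Properties as ℚ
import Data.Rational.Solver as ℚSolver
import Data.Rational.Unnormalised as ℚᵘ
import Data.Rational.Unnormalised.Properties as ℚᵘ
open import Data.Sum using (inj₁; inj₂)
import Data.Vec.Properties as Vec
open import Function using (_∘_; case_of_)
open import Level using (0ℓ)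
open import Relation.Binary.PropositionalEquality
  using (_≡_; _≢_; refl; sym; trans; cong; cong₂; subst; subst₂; module ≡-Reasoning)
open import Relation.Nullary using (¬_; Dec; yes; no; ¬?; contradiction)
open import Relation.Nullary.Decidable using (decidable-stable)
open import Relation.Unary using (Pred; Decidable)
open import Defs

open ℚSolver.+-*-Solver using (solve; _:+_; _:*_; _:-_; _:=_; con)

-- Counting in lists

private
  variable
    A B : Set
    P Q : Pred A 0ℓ

length-filter-map : (P? : Decidable P) (f : B → A) (xs : List B) →
                    length (filter P? (map f xs)) ≡ length (filter (P? ∘ f) xs)
length-filter-map P? f []       = refl
length-filter-map P? f (x ∷ xs) with P? (f x)
... | yes _ = cong suc (length-filter-map P? f xs)
... | no  _ = length-filter-map P? f xs

length-filter-cartesianProduct : {R : Pred (A × B) 0ℓ} (R? : Decidable R) (xs : List A) (ys : List B) →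
  length (filter R? (cartesianProduct xs ys)) ≡ sum (map (λ x → length (filter (λ y → R? (x , y)) ys)) xs)
length-filter-cartesianProduct R? []       ys = refl
length-filter-cartesianProduct R? (x ∷ xs) ys = begin
  length (filter R? (map (x ,_) ys ++ zs))
    ≡⟨ cong length (List.filter-++ R? (map (x ,_) ys) zs) ⟩
  length (filter R? (map (x ,_) ys) ++ filter R? zs)
    ≡⟨ List.length-++ (filter R? (map (x ,_) ys)) ⟩
  length (filter R? (map (x ,_) ys)) + length (filter R? zs)
    ≡⟨ cong₂ _+_ (length-filter-map R? (x ,_) ys) (length-filter-cartesianProduct R? xs ys) ⟩
  _ ∎
  where
  open ≡-Reasoning
  zs = cartesianProduct xs ys

-- The inductive step of `double-counting`: a new row `x` raises the column count of `y` by one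
-- exactly when `R x y`, hence the total by the length of its own row.
sum-length-filter-∷ : {R : A → B → Set} (R? : ∀ a b → Dec (R a b)) (x : A) (xs : List A) (ys : List B) →
  sum (map (λ y → length (filter (λ a → R? a y) (x ∷ xs))) ys) ≡
  length (filter (R? x) ys) + sum (map (λ y → length (filter (λ a → R? a y) xs)) ys)
sum-length-filter-∷ R? x xs []       = refl
sum-length-filter-∷ R? x xs (y ∷ ys) with R? x y
... | yes _ = cong suc (trans (cong (λ t → length (filter (λ a → R? a y) xs) + t) (sum-length-filter-∷ R? x xs ys))
                              (x∙yz≈y∙xz (length (filter (λ a → R? a y) xs)) (length (filter (R? x) ys)) _))
... | no  _ = trans (cong (λ t → length (filter (λ a → R? a y) xs) + t) (sum-length-filter-∷ R? x xs ys))
                    (x∙yz≈y∙xz (length (filter (λ a → R? a y) xs)) (length (filter (R? x) ys)) _)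

-- Both sums count the pairs in `R`, by rows on the left and by columns on the right.
double-counting : {R : A → B → Set} (R? : ∀ a b → Dec (R a b)) (xs : List A) (ys : List B) →
  sum (map (λ x → length (filter (R? x) ys)) xs) ≡ sum (map (λ y → length (filter (λ x → R? x y) xs)) ys)
double-counting R? []       ys = sym (zeros ys)
  where
  zeros : ∀ ys → sum (map (λ _ → 0) ys) ≡ 0
  zeros []       = refl
  zeros (_ ∷ ys) = zeros ys
double-counting R? (x ∷ xs) ys = trans
  (cong (λ t → length (filter (R? x) ys) + t) (double-counting R? xs ys))
  (sym (sum-length-filter-∷ R? x xs ys))

*-length-≤-sum : (f : A → ℕ) (k : ℕ) {xs : List A} → All (λ x → k ≤ f x) xs → k * length xs ≤ sum (map f xs)
*-length-≤-sum f k []                      = ≤-reflexive (*-zeroʳ k)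
*-length-≤-sum f k {x ∷ xs} (k≤fx ∷ k≤fxs) =
  ≤-trans (≤-reflexive (*-suc k (length xs))) (+-mono-≤ k≤fx (*-length-≤-sum f k k≤fxs))

sum-≤-length-* : (f : A → ℕ) (k : ℕ) → (∀ x → f x ≤ k) → ∀ xs → sum (map f xs) ≤ length xs * k
sum-≤-length-* f k f≤k []       = z≤n
sum-≤-length-* f k f≤k (x ∷ xs) = +-mono-≤ (f≤k x) (sum-≤-length-* f k f≤k xs)

-- The witness is an entry of maximal `f`, carried through the recursion; the maximum dominates the
-- average.
pigeonhole⁺ : (f : A → ℕ) (x : A) (xs : List A) →
              ∃ λ y → y ∈ x ∷ xs × sum (map f (x ∷ xs)) ≤ length (x ∷ xs) * f y
pigeonhole⁺ f x []        = x , here refl , ≤-refl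
pigeonhole⁺ f x (x′ ∷ xs) with pigeonhole⁺ f x′ xs
... | y , y∈ , Σ≤ with ≤-total (f x) (f y)
...   | inj₁ fx≤fy = y , there y∈ , +-mono-≤ fx≤fy Σ≤
...   | inj₂ fy≤fx = x , here refl , +-monoʳ-≤ (f x) (≤-trans Σ≤ (*-monoʳ-≤ (length (x′ ∷ xs)) fy≤fx))

-- A positive sum excludes the empty list, so the incidence bounds themselves supply nonemptiness of
-- the family that is searched.
pigeonhole : (f : A → ℕ) (xs : List A) → 0 < sum (map f xs) →
             ∃ λ y → y ∈ xs × sum (map f xs) ≤ length xs * f y
pigeonhole f (x ∷ xs) _ = pigeonhole⁺ f x xs

-- Each discarded entry costs at most `t` after scaling by `c`, and at most `length xs` entries are
-- discarded. The scaling expresses the threshold t / c without leaving the naturals.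
sum-filter-unpopular : (f : A → ℕ) (P? : Decidable P) (c t : ℕ) → (∀ x → ¬ P x → c * f x ≤ t) → ∀ xs →
  c * sum (map f xs) ≤ c * sum (map f (filter P? xs)) + length xs * t
sum-filter-unpopular f P? c t small []       = m≤m+n (c * 0) 0
sum-filter-unpopular f P? c t small (x ∷ xs) with P? x
... | yes _ = begin
  c * (f x + Σ)                  ≡⟨ *-distribˡ-+ c (f x) Σ ⟩
  c * f x + c * Σ                ≤⟨ +-monoʳ-≤ (c * f x) ih ⟩
  -- A kept entry is charged `t` as well, so that the loss is measured against the whole list.
  c * f x + (c * Σ′ + l * t)     ≤⟨ +-monoʳ-≤ (c * f x) (+-monoʳ-≤ (c * Σ′) (m≤n+m (l * t) t)) ⟩
  c * f x + (c * Σ′ + (t + l * t)) ≡⟨ regroup c (f x) Σ′ (t + l * t) ⟩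
  c * (f x + Σ′) + (t + l * t)   ∎
  where
  open ≤-Reasoning
  Σ = sum (map f xs)
  Σ′ = sum (map f (filter P? xs))
  l = length xs
  ih = sum-filter-unpopular f P? c t small xs
  regroup : ∀ c a b d → c * a + (c * b + d) ≡ c * (a + b) + d
  regroup = solve-∀
... | no ¬Px = begin
  c * (f x + Σ)                  ≡⟨ *-distribˡ-+ c (f x) Σ ⟩
  c * f x + c * Σ                ≤⟨ +-mono-≤ (small x ¬Px) ih ⟩
  t + (c * Σ′ + l * t)           ≡⟨ x∙yz≈y∙xz t (c * Σ′) (l * t) ⟩
  c * Σ′ + (t + l * t)           ∎
  where
  open ≤-Reasoning
  Σ = sum (map f xs)
  Σ′ = sum (map f (filter P? xs))
  l = length xs
  ih = sum-filter-unpopular f P? c t small xs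

-- For a list of length l the threshold is t / (2l), half of the average of a total t, so discarding
-- below it loses at most t / 2. Only a lower bound `t` on the total enters, which covers both later
-- uses, t = I and t = Mm.
popularity : (f : A → ℕ) (P? : Decidable P) (t : ℕ) (xs : List A) .{{_ : NonZero (length xs)}} →
  t ≤ sum (map f xs) → (∀ x → ¬ P x → 2 * length xs * f x ≤ t) → t ≤ 2 * sum (map f (filter P? xs))
popularity f P? t xs t≤Σ small = *-cancelˡ-≤ l (+-cancelʳ-≤ (l * t) _ _ (begin
  l * t + l * t          ≡⟨ double l t ⟩
  2 * l * t              ≤⟨ *-monoʳ-≤ (2 * l) t≤Σ ⟩
  2 * l * sum (map f xs) ≤⟨ sum-filter-unpopular f P? (2 * l) t small xs ⟩
  2 * l * Σ′ + l * t     ≡⟨ cong (_+ l * t) (regroup l Σ′) ⟩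
  l * (2 * Σ′) + l * t   ∎))
  where
  open ≤-Reasoning
  l = length xs
  Σ′ = sum (map f (filter P? xs))
  double : ∀ a b → a * b + a * b ≡ 2 * a * b
  double = solve-∀
  regroup : ∀ a b → 2 * a * b ≡ a * (2 * b)
  regroup = solve-∀

-- Serves the rest of the list in `length-filter-filter-one`, after the exceptional entry has been
-- met.
length-filter-filter : (P? : Decidable P) (Q? : Decidable Q) {xs : List A} → All (λ x → P x → Q x) xs →
                       length (filter P? xs) ≤ length (filter P? (filter Q? xs))
length-filter-filter P? Q? []                     = z≤n
length-filter-filter P? Q? (_∷_ {x = x} P⇒Q P⇒Qs) with Q? x
... | yes _ with P? x
...   | yes _ = s≤s (length-filter-filter P? Q? P⇒Qs)
...   | no  _ = length-filter-filter P? Q? P⇒Qs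
length-filter-filter P? Q? (_∷_ {x = x} P⇒Q P⇒Qs) | no ¬Qx with P? x
...   | yes Px = contradiction (P⇒Q Px) ¬Qx
...   | no  _  = length-filter-filter P? Q? P⇒Qs

-- Every entry lost by the inner filter but counted by the outer one equals `a`, and a
-- duplicate-free list has room for `a` only once.
length-filter-filter-one : (P? : Decidable P) (Q? : Decidable Q) (a : A) {xs : List A} → Unique xs →
  (∀ x → P x → ¬ Q x → x ≡ a) → length (filter P? xs) ≤ suc (length (filter P? (filter Q? xs)))
length-filter-filter-one P? Q? a [] P∖Q = z≤n
length-filter-filter-one {P = P} {Q = Q} P? Q? a (_∷_ {x = x} {xs = xs} x∉xs uniq) P∖Q with Q? x
... | yes _ with P? x
...   | yes _ = s≤s (length-filter-filter-one P? Q? a uniq P∖Q)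
...   | no  _ = length-filter-filter-one P? Q? a uniq P∖Q
length-filter-filter-one {P = P} {Q = Q} P? Q? a (_∷_ {x = x} {xs = xs} x∉xs uniq) P∖Q | no ¬Qx with P? x
-- Here `x` is the exception and pays for the `suc`; a second one in the tail would equal it,
-- against uniqueness.
...   | yes Px = s≤s (length-filter-filter P? Q? (All.map step x∉xs))
  where
  step : ∀ {y} → x ≢ y → P y → Q y
  step {y} x≢y Py with Q? y
  ... | yes Qy = Qy
  ... | no ¬Qy = contradiction (trans (P∖Q x Px ¬Qx) (sym (P∖Q y Py ¬Qy))) x≢y
...   | no  _  = length-filter-filter-one P? Q? a uniq P∖Q

-- Pairs of spheres with many common rich points

m*n>0⇒n>0 : ∀ m n → 0 < m * n → 0 < n
m*n>0⇒n>0 m zero    0<m*0 = subst (0 <_) (*-zeroʳ m) 0<m*0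
m*n>0⇒n>0 m (suc n) _     = s≤s z≤n

module _ {q : ℕ} (F : FiniteField q) {d : ℕ} (Q : QuadraticForm F d) where
  open Spheres F Q

  incidences≡∑degree : ∀ P 𝒮 → incidences P 𝒮 ≡ sum (map (degree 𝒮) P)
  incidences≡∑degree P 𝒮 = length-filter-cartesianProduct (λ (p , S) → p ∈ˢ? S) P 𝒮

  nonconcentric? : ∀ S S′ → Dec (Nonconcentric S S′)
  nonconcentric? S S′ = ¬? (Vec.≡-dec (FiniteField._≟_ F) (center S) (center S′))

  -- A point lies on at most one sphere of each center.
  degree-nonconcentric : ∀ {𝒮} → Unique 𝒮 → ∀ S₀ p → p ∈ˢ S₀ →
                         degree 𝒮 p ≤ suc (degree (filter (nonconcentric? S₀) 𝒮) p)
  degree-nonconcentric uniq S₀@(c₀ , r₀) p p∈S₀ =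
    length-filter-filter-one (p ∈ˢ?_) (nonconcentric? S₀) S₀ uniq concentric⇒≡
    where
    concentric⇒≡ : ∀ S → p ∈ˢ S → ¬ Nonconcentric S₀ S → S ≡ S₀
    concentric⇒≡ S@(c , r) p∈S conc
      with refl ← decidable-stable (Vec.≡-dec (FiniteField._≟_ F) c₀ c) conc
      = cong (c ,_) (trans (sym p∈S) p∈S₀)

  -- The combinatorial core, in natural numbers only: the two conditions on `M` pin it to ⌈I /
  -- (2n)⌉, fractions are cleared, and I² ≤ 8ns²|P′| stands in for (1), since K and C₁ enter only
  -- afterwards.
  rich-pair : (P : List Point) → Unique P → .{{_ : NonZero (length P)}} →
              (𝒮 : List Sphere) → Unique 𝒮 → .{{_ : NonZero (length 𝒮)}} →
              (M : ℕ) →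
              let n = length P
                  s = length 𝒮
                  I = incidences P 𝒮
              in
              I ≤ M * (2 * n) → (∀ k → I ≤ k * (2 * n) → M ≤ k) → 8 * n ≤ I →
              ∃[ S₀ ] ∃[ S₁ ] ∃[ P′ ] ∃[ 𝒮′ ]
                S₀ ∈ 𝒮 × S₁ ∈ 𝒮 × Nonconcentric S₀ S₁ ×
                Unique P′ × All (λ p → p ∈ P × p ∈ˢ S₀ × p ∈ˢ S₁) P′ ×
                Unique 𝒮′ × 𝒮′ ⊆ 𝒮 ×
                I * I ≤ 8 * n * s * s * length P′ ×
                All (λ p → M ≤ degree 𝒮 p) P′ ×
                All (λ S → M * length P′ ≤ ∣ P′ ∩ S ∣ * (2 * s)) 𝒮′ ×
                M * length P′ ≤ 2 * sum (map (λ S → ∣ P′ ∩ S ∣) 𝒮′) ×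
                M ≤ 2 * length 𝒮′
  rich-pair P uniqP 𝒮 uniq𝒮 M I≤2nM least 8n≤I =
    S₀ , S₁ , P′ , 𝒮′ , S₀∈𝒮 , proj₁ S₁∈ , proj₂ S₁∈ ,
    Unique.filter⁺ _ (Unique.filter⁺ _ (Unique.filter⁺ _ uniqP)) ,
    All.tabulate (λ p∈P′ → p∈P p∈P′ , p∈S₀ p∈P′ , p∈S₁ p∈P′) ,
    Unique.filter⁺ _ uniq𝒮 , filter-⊆ _ 𝒮 ,
    I²≤8ns²m , M≤degree , All.all-filter popular? 𝒮 , Mm≤2∑ , M≤2∣𝒮′∣
    where
    open ≤-Reasoning
    n s I : ℕ
    n = length P
    s = length 𝒮
    I = incidences P 𝒮

    0<I : 0 < I
    0<I = <-≤-trans (8n>0 n) 8n≤I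
      where
      8n>0 : ∀ n .{{_ : NonZero n}} → 0 < 8 * n
      8n>0 (suc _) = s≤s z≤n

    rich? : ∀ p → Dec (M ≤ degree 𝒮 p)
    rich? p = M ≤? degree 𝒮 p

    P₁ : List Point
    P₁ = filter rich? P

    -- By minimality of `M`: a degree e with I < 2ne would compete for the ceiling and so be at
    -- least `M`.
    poor : ∀ p → ¬ M ≤ degree 𝒮 p → 2 * n * degree 𝒮 p ≤ I
    poor p M≰d = ≮⇒≥ λ I<2nd → M≰d (least (degree 𝒮 p)
      (≤-trans (<⇒≤ I<2nd) (≤-reflexive (*-comm (2 * n) (degree 𝒮 p)))))

    -- Here the `t` of `popularity` is the exact total I; double counting then passes from degrees
    -- of points to loads of spheres.
    I≤2∑ : I ≤ 2 * sum (map (λ S → ∣ P₁ ∩ S ∣) 𝒮)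
    I≤2∑ = subst (λ t → I ≤ 2 * t) (double-counting _∈ˢ?_ P₁ 𝒮)
      (popularity (degree 𝒮) rich? I P (≤-reflexive (incidences≡∑degree P 𝒮)) poor)

    first : ∃ λ S → S ∈ 𝒮 × sum (map (λ S → ∣ P₁ ∩ S ∣) 𝒮) ≤ s * ∣ P₁ ∩ S ∣
    first = pigeonhole (λ S → ∣ P₁ ∩ S ∣) 𝒮 (m*n>0⇒n>0 2 _ (<-≤-trans 0<I I≤2∑))

    S₀ : Sphere
    S₀ = proj₁ first

    S₀∈𝒮 : S₀ ∈ 𝒮
    S₀∈𝒮 = proj₁ (proj₂ first)

    P₂ : List Point
    P₂ = filter (_∈ˢ? S₀) P₁

    𝒮* : List Sphere
    𝒮* = filter (nonconcentric? S₀) 𝒮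

    -- Truncated subtraction is harmless: 0 < I and `I≤4n[M-1]` force M ≥ 2.
    M-1≤degree* : All (λ p → M ∸ 1 ≤ degree 𝒮* p) P₂
    M-1≤degree* = All.tabulate λ {p} p∈P₂ →
      let p∈P₁ , p∈S₀ = ∈-filter⁻ (_∈ˢ? S₀) p∈P₂
          _    , M≤d  = ∈-filter⁻ rich? {xs = P} p∈P₁
      in m≤n+o⇒m∸n≤o M 1 (≤-trans M≤d (degree-nonconcentric uniq𝒮 S₀ p p∈S₀))

    T : ℕ
    T = sum (map (λ S → ∣ P₂ ∩ S ∣) 𝒮*)

    [M-1]∣P₂∣≤T : (M ∸ 1) * length P₂ ≤ T
    [M-1]∣P₂∣≤T = ≤-trans (*-length-≤-sum (degree 𝒮*) (M ∸ 1) M-1≤degree*)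
      (≤-reflexive (double-counting _∈ˢ?_ P₂ 𝒮*))

    -- In 2I ≤ 4nM, passing from M to M - 1 costs 4n; since 4n ≤ 8n ≤ I, one of the two copies of I
    -- absorbs this cost.
    I≤4n[M-1] : I ≤ 4 * n * (M ∸ 1)
    I≤4n[M-1] = +-cancelʳ-≤ (4 * n) _ _ (begin
      I + 4 * n                    ≤⟨ +-monoʳ-≤ I (≤-trans (*-monoˡ-≤ n (m≤m+n 4 4)) 8n≤I) ⟩
      I + I                        ≡⟨ double I ⟩
      2 * I                        ≤⟨ *-monoʳ-≤ 2 I≤2nM ⟩
      2 * (M * (2 * n))            ≤⟨ *-monoʳ-≤ 2 (*-monoˡ-≤ (2 * n) (m≤n+m∸n M 1)) ⟩
      2 * ((1 + (M ∸ 1)) * (2 * n)) ≡⟨ expand n (M ∸ 1) ⟩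
      4 * n * (M ∸ 1) + 4 * n      ∎)
      where
      double : ∀ a → a + a ≡ 2 * a
      double = solve-∀
      expand : ∀ a b → 2 * ((1 + b) * (2 * a)) ≡ 4 * a * b + 4 * a
      expand = solve-∀

    -- The two factors I are bounded differently, once through M - 1 and once through |P₂|, so that
    -- (M - 1)|P₂| appears in the product.
    I²≤8nsT : I * I ≤ 8 * n * s * T
    I²≤8nsT = begin
      I * I
        ≤⟨ *-mono-≤ I≤4n[M-1] (≤-trans I≤2∑ (*-monoʳ-≤ 2 (proj₂ (proj₂ first)))) ⟩
      4 * n * (M ∸ 1) * (2 * (s * length P₂))
        ≡⟨ regroup n (M ∸ 1) s (length P₂) ⟩
      8 * n * s * ((M ∸ 1) * length P₂)
        ≤⟨ *-monoʳ-≤ (8 * n * s) [M-1]∣P₂∣≤T ⟩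
      8 * n * s * T ∎
      where
      regroup : ∀ a b c e → 4 * a * b * (2 * (c * e)) ≡ 8 * a * c * (b * e)
      regroup = solve-∀

    -- I² > 0 forces T > 0, so there is a sphere not concentric to `S₀` to choose from.
    second : ∃ λ S → S ∈ 𝒮* × T ≤ length 𝒮* * ∣ P₂ ∩ S ∣
    second = pigeonhole (λ S → ∣ P₂ ∩ S ∣) 𝒮*
      (m*n>0⇒n>0 (8 * n * s) T (<-≤-trans (*-mono-< 0<I 0<I) I²≤8nsT))

    S₁ : Sphere
    S₁ = proj₁ second

    S₁∈ : S₁ ∈ 𝒮 × Nonconcentric S₀ S₁
    S₁∈ = ∈-filter⁻ (nonconcentric? S₀) (proj₁ (proj₂ second))

    P′ : List Point
    P′ = filter (_∈ˢ? S₁) P₂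

    m : ℕ
    m = length P′

    I²≤8ns²m : I * I ≤ 8 * n * s * s * m
    I²≤8ns²m = begin
      I * I                            ≤⟨ I²≤8nsT ⟩
      8 * n * s * T                    ≤⟨ *-monoʳ-≤ (8 * n * s) (proj₂ (proj₂ second)) ⟩
      8 * n * s * (length 𝒮* * m)      ≤⟨ *-monoʳ-≤ (8 * n * s)
                                            (*-monoˡ-≤ m (List.length-filter (nonconcentric? S₀) 𝒮)) ⟩
      8 * n * s * (s * m)              ≡⟨ *-assoc (8 * n * s) s m ⟨
      8 * n * s * s * m                ∎

    -- I² > 0 also makes m nonzero, as the cancellation in `M≤2∣𝒮′∣` requires.
    instance
      m-nonZero : NonZero m
      m-nonZero = >-nonZero (m*n>0⇒n>0 (8 * n * s * s) m (<-≤-trans (*-mono-< 0<I 0<I) I²≤8ns²m))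

    p∈P₂ : ∀ {p} → p ∈ P′ → p ∈ P₂
    p∈P₂ = filter-⊆ (_∈ˢ? S₁) P₂

    p∈S₁ : ∀ {p} → p ∈ P′ → p ∈ˢ S₁
    p∈S₁ p∈P′ = proj₂ (∈-filter⁻ (_∈ˢ? S₁) {xs = P₂} p∈P′)

    p∈S₀ : ∀ {p} → p ∈ P′ → p ∈ˢ S₀
    p∈S₀ p∈P′ = proj₂ (∈-filter⁻ (_∈ˢ? S₀) {xs = P₁} (p∈P₂ p∈P′))

    p∈P₁ : ∀ {p} → p ∈ P′ → p ∈ P × M ≤ degree 𝒮 p
    p∈P₁ p∈P′ = ∈-filter⁻ rich? (filter-⊆ (_∈ˢ? S₀) P₁ (p∈P₂ p∈P′))

    p∈P : ∀ {p} → p ∈ P′ → p ∈ P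
    p∈P p∈P′ = proj₁ (p∈P₁ p∈P′)

    M≤degree : All (λ p → M ≤ degree 𝒮 p) P′
    M≤degree = All.tabulate (λ p∈P′ → proj₂ (p∈P₁ p∈P′))

    popular? : ∀ S → Dec (M * m ≤ ∣ P′ ∩ S ∣ * (2 * s))
    popular? S = M * m ≤? ∣ P′ ∩ S ∣ * (2 * s)

    𝒮′ : List Sphere
    𝒮′ = filter popular? 𝒮

    -- This time `t` is only a lower bound for the total: each of the m points of `P′` has degree at
    -- least `M`.
    Mm≤2∑ : M * m ≤ 2 * sum (map (λ S → ∣ P′ ∩ S ∣) 𝒮′)
    Mm≤2∑ = popularity (λ S → ∣ P′ ∩ S ∣) popular? (M * m) 𝒮
      (≤-trans (*-length-≤-sum (degree 𝒮) M M≤degree) (≤-reflexive (double-counting _∈ˢ?_ P′ 𝒮)))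
      λ S ¬popular → ≤-trans (≤-reflexive (*-comm (2 * s) ∣ P′ ∩ S ∣)) (<⇒≤ (≰⇒> ¬popular))

    -- No sphere contains more than m points of `P′`, so the sum is at most m|𝒮′| and m cancels.
    M≤2∣𝒮′∣ : M ≤ 2 * length 𝒮′
    M≤2∣𝒮′∣ = *-cancelʳ-≤ M (2 * length 𝒮′) m (begin
      M * m                                  ≤⟨ Mm≤2∑ ⟩
      2 * sum (map (λ S → ∣ P′ ∩ S ∣) 𝒮′)    ≤⟨ *-monoʳ-≤ 2 (sum-≤-length-* (λ S → ∣ P′ ∩ S ∣) m
                                                  (λ S → List.length-filter (_∈ˢ? S) P′) 𝒮′) ⟩
      2 * (length 𝒮′ * m)                    ≡⟨ *-assoc 2 (length 𝒮′) m ⟨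
      2 * length 𝒮′ * m                      ∎)

-- Fractions

toℚᵘ-/ : ∀ i n .{{_ : NonZero n}} → toℚᵘ (i / n) ℚᵘ.≃ (i ℚᵘ./ n)
toℚᵘ-/ i n@(suc k) = ℚ.toℚᵘ-fromℚᵘ (ℚᵘ.mkℚᵘ i k)

/-cross-≤ : ∀ i j m n .{{_ : NonZero m}} .{{_ : NonZero n}} →
            i ℤ.* + n ℤ.≤ j ℤ.* + m → i / m ℚ.≤ j / n
/-cross-≤ i j m@(suc _) n@(suc _) h = ℚ.toℚᵘ-cancel-≤
  (ℚᵘ.≤-respˡ-≃ (ℚᵘ.≃-sym (toℚᵘ-/ i m)) (ℚᵘ.≤-respʳ-≃ (ℚᵘ.≃-sym (toℚᵘ-/ j n)) (ℚᵘ.*≤* h)))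

/-cross-≤⁻¹ : ∀ i j m n .{{_ : NonZero m}} .{{_ : NonZero n}} →
              i / m ℚ.≤ j / n → i ℤ.* + n ℤ.≤ j ℤ.* + m
/-cross-≤⁻¹ i j m@(suc _) n@(suc _) h = ℚᵘ.drop-*≤*
  (ℚᵘ.≤-respˡ-≃ (toℚᵘ-/ i m) (ℚᵘ.≤-respʳ-≃ (toℚᵘ-/ j n) (ℚ.toℚᵘ-mono-≤ h)))

+/-mono-≤ : ∀ a b c d .{{_ : NonZero b}} .{{_ : NonZero d}} →
            a * d ≤ c * b → + a / b ℚ.≤ + c / d
+/-mono-≤ a b c d h = /-cross-≤ (+ a) (+ c) b d
  (subst₂ ℤ._≤_ (ℤ.pos-* a d) (ℤ.pos-* c b) (ℤ.+≤+ h))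

+/-cancel-≤ : ∀ a b c d .{{_ : NonZero b}} .{{_ : NonZero d}} →
              + a / b ℚ.≤ + c / d → a * d ≤ c * b
+/-cancel-≤ a b c d h = ℤ.drop‿+≤+
  (subst₂ ℤ._≤_ (sym (ℤ.pos-* a d)) (sym (ℤ.pos-* c b)) (/-cross-≤⁻¹ (+ a) (+ c) b d h))

/-*-/ : ∀ a b c d .{{_ : NonZero b}} .{{_ : NonZero d}} →
        (+ a / b) ℚ.* (+ c / d) ≡ (+ (a * c) / (b * d)) {{m*n≢0 b d}}
/-*-/ a b@(suc _) c d@(suc _) = ℚ.toℚᵘ-injective (begin
  toℚᵘ ((+ a / b) ℚ.* (+ c / d))             ≈⟨ ℚ.toℚᵘ-homo-* (+ a / b) (+ c / d) ⟩
  toℚᵘ (+ a / b) ℚᵘ.* toℚᵘ (+ c / d)         ≈⟨ ℚᵘ.*-cong (toℚᵘ-/ (+ a) b) (toℚᵘ-/ (+ c) d) ⟩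
  (+ a ℚᵘ./ b) ℚᵘ.* (+ c ℚᵘ./ d)             ≡⟨ cong (ℚᵘ._/ (b * d)) (sym (ℤ.pos-* a c)) ⟩
  (+ (a * c) ℚᵘ./ (b * d))               ≈⟨ toℚᵘ-/ (+ (a * c)) (b * d) ⟨
  toℚᵘ (+ (a * c) / (b * d))             ∎)
  where open ℚᵘ.≃-Reasoning

/-+-/ : ∀ a b c .{{_ : NonZero c}} → (+ a / c) ℚ.+ (+ b / c) ≡ + (a + b) / c
/-+-/ a b c@(suc _) = ℚ.toℚᵘ-injective (begin
  toℚᵘ ((+ a / c) ℚ.+ (+ b / c))         ≈⟨ ℚ.toℚᵘ-homo-+ (+ a / c) (+ b / c) ⟩
  toℚᵘ (+ a / c) ℚᵘ.+ toℚᵘ (+ b / c)     ≈⟨ ℚᵘ.+-cong (toℚᵘ-/ (+ a) c) (toℚᵘ-/ (+ b) c) ⟩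
  (+ a ℚᵘ./ c) ℚᵘ.+ (+ b ℚᵘ./ c)         ≈⟨ ℚᵘ.*≡* (common (+ a) (+ b) (+ c)) ⟩
  + (a + b) ℚᵘ./ c                     ≈⟨ toℚᵘ-/ (+ (a + b)) c ⟨
  toℚᵘ (+ (a + b) / c)                 ∎)
  where
  open ℚᵘ.≃-Reasoning
  module S = ℤSolver.+-*-Solver
  common : ∀ a b c → (a ℤ.* c ℤ.+ b ℤ.* c) ℤ.* c ≡ (a ℤ.+ b) ℤ.* (c ℤ.* c)
  common = S.solve 3 (λ a b c → (a S.:* c S.:+ b S.:* c) S.:* c S.:= (a S.:+ b) S.:* (c S.:* c)) refl

fromℕ-mono-≤ : ∀ {a b} → a ≤ b → fromℕ a ℚ.≤ fromℕ b
fromℕ-mono-≤ {a} {b} h = +/-mono-≤ a 1 b 1 (*-monoˡ-≤ 1 h)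

fromℕ-* : ∀ a b → fromℕ (a * b) ≡ fromℕ a ℚ.* fromℕ b
fromℕ-* a b = sym (/-*-/ a 1 b 1)

/-*-fromℕ-≤ : ∀ a b c e .{{_ : NonZero b}} → a * c ≤ e * b → (+ a / b) ℚ.* fromℕ c ℚ.≤ fromℕ e
/-*-fromℕ-≤ a b c e h = subst (ℚ._≤ fromℕ e) (sym (/-*-/ a b c 1))
  (+/-mono-≤ (a * c) (b * 1) e 1 {{m*n≢0 b 1}}
    (subst₂ _≤_ (sym (*-identityʳ _)) (cong (e *_) (sym (*-identityʳ b))) h))

-- Floors and ceilings of rationals

⌊p⌋*↧p≤↥p : ∀ p → floor p ℤ.* ↧ p ℤ.≤ ↥ p
⌊p⌋*↧p≤↥p p@record{} = ℤ.[n/d]*d≤n (↥ p) (↧ p)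

↥p<suc⌊p⌋*↧p : ∀ p → ↥ p ℤ.< ℤ.suc (floor p) ℤ.* ↧ p
↥p<suc⌊p⌋*↧p p@record{} = subst (λ f → ↥ p ℤ.< ℤ.suc f ℤ.* ↧ p)
  (sym (ℤ.div-pos-is-/ℕ (↥ p) (↧ₙ p))) (ℤ.n<s[n/ℕd]*d (↥ p) (↧ₙ p))

⌈p⌉≡-⌊-p⌋ : ∀ p → ceiling p ≡ ℤ.- floor (ℚ.- p)
⌈p⌉≡-⌊-p⌋ record{} = refl

-- This is the floor bound for -p, negated.
↥p≤⌈p⌉*↧p : ∀ p → ↥ p ℤ.≤ ceiling p ℤ.* ↧ p
↥p≤⌈p⌉*↧p p = begin
  ↥ p                                    ≡⟨ ℤ.neg-involutive (↥ p) ⟨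
  ℤ.- ℤ.- ↥ p                            ≡⟨ cong ℤ.-_ (ℚ.↥-neg p) ⟨
  ℤ.- ↥ (ℚ.- p)                          ≤⟨ ℤ.neg-mono-≤ (⌊p⌋*↧p≤↥p (ℚ.- p)) ⟩
  ℤ.- (floor (ℚ.- p) ℤ.* ↧ (ℚ.- p))      ≡⟨ ℤ.neg-distribˡ-* (floor (ℚ.- p)) (↧ (ℚ.- p)) ⟩
  ℤ.- floor (ℚ.- p) ℤ.* ↧ (ℚ.- p)        ≡⟨ cong₂ ℤ._*_ (sym (⌈p⌉≡-⌊-p⌋ p)) (ℚ.↧-neg p) ⟩
  ceiling p ℤ.* ↧ p                      ∎
  where open ℤ.≤-Reasoning

p≤⌈p⌉ : ∀ p → p ℚ.≤ ceiling p / 1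
p≤⌈p⌉ p = subst (ℚ._≤ ceiling p / 1) (ℚ.↥p/↧p≡p p)
  (/-cross-≤ (↥ p) (ceiling p) (↧ₙ p) 1
    (subst (ℤ._≤ ceiling p ℤ.* ↧ p) (sym (ℤ.*-identityʳ (↥ p))) (↥p≤⌈p⌉*↧p p)))

-- If k < ⌈p⌉, then ⌊-p⌋ < -k and so ⌊-p⌋ + 1 ≤ -k by integrality; but -p < ⌊-p⌋ + 1 then gives -p <
-- -k, against p ≤ k. The chain runs this with denominators cleared.
⌈p⌉-least : ∀ p k → p ℚ.≤ k / 1 → ceiling p ℤ.≤ k
⌈p⌉-least p k p≤k = ℤ.≮⇒≥ λ k<⌈p⌉ → ℤ.<-irrefl refl (begin-strict
  ℤ.- ↥ p                                  ≡⟨ ℚ.↥-neg p ⟨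
  ↥ (ℚ.- p)                                <⟨ ↥p<suc⌊p⌋*↧p (ℚ.- p) ⟩
  ℤ.suc (floor (ℚ.- p)) ℤ.* ↧ (ℚ.- p)      ≡⟨ cong (ℤ.suc (floor (ℚ.- p)) ℤ.*_) (ℚ.↧-neg p) ⟩
  ℤ.suc (floor (ℚ.- p)) ℤ.* ↧ p            ≤⟨ ℤ.*-monoʳ-≤-nonNeg (↧ p) (ℤ.i<j⇒suc[i]≤j (⌊-p⌋<-k k<⌈p⌉)) ⟩
  ℤ.- k ℤ.* ↧ p                            ≡⟨ ℤ.neg-distribˡ-* k (↧ p) ⟨
  ℤ.- (k ℤ.* ↧ p)                          ≤⟨ ℤ.neg-mono-≤ cross ⟩
  ℤ.- ↥ p                                  ∎)
  where
  open ℤ.≤-Reasoning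
  ⌊-p⌋<-k : k ℤ.< ceiling p → floor (ℚ.- p) ℤ.< ℤ.- k
  ⌊-p⌋<-k k<⌈p⌉ = subst (ℤ._< ℤ.- k) (trans (cong ℤ.-_ (⌈p⌉≡-⌊-p⌋ p)) (ℤ.neg-involutive _)) (ℤ.neg-mono-< k<⌈p⌉)
  cross : ↥ p ℤ.≤ k ℤ.* ↧ p
  cross = subst (ℤ._≤ k ℤ.* ↧ p) (ℤ.*-identityʳ (↥ p))
    (/-cross-≤⁻¹ (↥ p) k (↧ₙ p) 1 (subst (ℚ._≤ k / 1) (sym (ℚ.↥p/↧p≡p p)) p≤k))

-- Replaces the integer ceiling by a natural number and the two inequalities through which
-- `rich-pair` knows it.
⌈/⌉-spec : ∀ a b .{{_ : NonZero b}} →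
           ∃ λ m → ceiling (+ a / b) ≡ + m × a ≤ m * b × (∀ k → a ≤ k * b → m ≤ k)
⌈/⌉-spec a b with ceiling (+ a / b) | p≤⌈p⌉ (+ a / b) | ⌈p⌉-least (+ a / b)
... | + m      | a/b≤m | least = m , refl
  , subst (_≤ m * b) (*-identityʳ a) (+/-cancel-≤ a b m 1 a/b≤m)
  , λ k a≤kb → ℤ.drop‿+≤+ (least (+ k) (+/-mono-≤ a b k 1 (subst (_≤ k * b) (sym (*-identityʳ a)) a≤kb)))
-- A negative ceiling would put the nonnegative a below a negative multiple of b.
... | -[1+ m ] | a/b≤m | _ = contradiction
  (ℤ.≤-<-trans (subst (+ 0 ℤ.≤_) (ℤ.pos-* a 1) (ℤ.+≤+ z≤n))
    (ℤ.≤-<-trans (/-cross-≤⁻¹ (+ a) -[1+ m ] b 1 a/b≤m) (neg b)))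
  (ℤ.<-irrefl refl)
  where
  neg : ∀ n .{{_ : NonZero n}} → -[1+ m ] ℤ.* + n ℤ.< + 0
  neg (suc _) = ℤ.-<+

-- Order and multiplication of reals

≤ℝ-eventually : ∀ {x y} N → (∀ n → N ≤ n → seq x n ℚ.≤ seq y n) → x ≤ℝ y
≤ℝ-eventually {x} {y} N h ε = N , λ n N≤n → begin
  seq x n          ≤⟨ h n N≤n ⟩
  seq y n          ≡⟨ ℚ.+-identityʳ (seq y n) ⟨
  seq y n ℚ.+ 0ℚ   ≤⟨ ℚ.+-monoʳ-≤ (seq y n) (ℚ.<⇒≤ (ℚ.positive⁻¹ ε)) ⟩
  seq y n ℚ.+ ε    ∎
  where open ℚ.≤-Reasoning

≤ℝ-pointwise : ∀ {x y} → (∀ n → seq x n ≡ seq y n) → x ≤ℝ y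
≤ℝ-pointwise {x} {y} x≡y = ≤ℝ-eventually {x} {y} 0 λ n _ → ℚ.≤-reflexive (x≡y n)

≤ℝ-refl : ∀ {x} → x ≤ℝ x
≤ℝ-refl {x} = ≤ℝ-pointwise {x} {x} λ _ → refl

≤ℝ-trans : ∀ {x y z} → x ≤ℝ y → y ≤ℝ z → x ≤ℝ z
≤ℝ-trans {x} {y} {z} x≤y y≤z ε =
  let instance
        _ : Positive (½ ℚ.* ε)
        _ = ℚ.pos*pos⇒pos ½ ε
      N , hx = x≤y (½ ℚ.* ε)
      L , hy = y≤z (½ ℚ.* ε)
  in N ⊔ L , λ n N⊔L≤n → begin
    seq x n
      ≤⟨ hx n (m⊔n≤o⇒m≤o N L N⊔L≤n) ⟩
    seq y n ℚ.+ ½ ℚ.* ε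
      ≤⟨ ℚ.+-monoˡ-≤ (½ ℚ.* ε) (hy n (m⊔n≤o⇒n≤o N L N⊔L≤n)) ⟩
    seq z n ℚ.+ ½ ℚ.* ε ℚ.+ ½ ℚ.* ε
      ≡⟨ solve 2 (λ z e → z :+ con ½ :* e :+ con ½ :* e := z :+ e) refl (seq z n) ε ⟩
    seq z n ℚ.+ ε ∎
  where open ℚ.≤-Reasoning

-- Unlike 0ℝ ≤ℝ x, this is preserved by products with no further argument.
NonNegℝ : ℝ → Set
NonNegℝ x = ∃ λ N → ∀ n → N ≤ n → 0ℚ ℚ.≤ seq x n

pos⇒nonNegℝ : ∀ {x} → 0ℝ <ℝ x → NonNegℝ x
pos⇒nonNegℝ {x} (δ , δ>0 , N , h) = N , λ n N≤n →
  ℚ.≤-trans (ℚ.<⇒≤ (ℚ.positive⁻¹ δ {{δ>0}}))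
    (subst (ℚ._≤ seq x n) (ℚ.+-identityˡ δ) (h n N≤n))

ι-nonNegℝ : ∀ n → NonNegℝ (ι n)
ι-nonNegℝ n = 0 , λ _ _ → fromℕ-mono-≤ {0} {n} z≤n

*ℝ-nonNegℝ : ∀ {x y} → NonNegℝ x → NonNegℝ y → NonNegℝ (x *ℝ y)
*ℝ-nonNegℝ {x} {y} (N , hx) (L , hy) = N ⊔ L , λ n N⊔L≤n →
  let 0≤x = hx n (m⊔n≤o⇒m≤o N L N⊔L≤n)
      0≤y = hy n (m⊔n≤o⇒n≤o N L N⊔L≤n)
  in subst (ℚ._≤ seq x n ℚ.* seq y n) (ℚ.*-zeroˡ (seq y n))
       (ℚ.*-monoʳ-≤-nonNeg (seq y n) {{ℚ.nonNegative 0≤y}} 0≤x)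

p≤∣p∣ : ∀ p → p ℚ.≤ ℚ.∣ p ∣
p≤∣p∣ p with ℚ.≤-total 0ℚ p
... | inj₁ 0≤p = ℚ.≤-reflexive (sym (ℚ.0≤p⇒∣p∣≡p 0≤p))
... | inj₂ p≤0 = ℚ.≤-trans p≤0 (ℚ.0≤∣p∣ p)

bounded-above : ∀ x → ∃ λ B → Positive B × ∃ λ N → ∀ n → N ≤ n → seq x n ℚ.≤ B
bounded-above x =
  let N , h = cauchy x 1ℚ
      a = seq x N
  in 1ℚ ℚ.+ ℚ.∣ a ∣ , ℚ.pos+nonNeg⇒pos 1ℚ ℚ.∣ a ∣ {{ℚ.∣-∣-nonNeg a}} , N , λ n N≤n → begin
    seq x n                ≡⟨ solve 2 (λ b c → b := (b :- c) :+ c) refl (seq x n) a ⟩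
    (seq x n ℚ.- a) ℚ.+ a  ≤⟨ ℚ.+-mono-≤ (ℚ.≤-trans (p≤∣p∣ (seq x n ℚ.- a)) (h n N N≤n ≤-refl)) (p≤∣p∣ a) ⟩
    1ℚ ℚ.+ ℚ.∣ a ∣         ∎
  where open ℚ.≤-Reasoning

divide-pos : ∀ ε B .{{_ : Positive ε}} → Positive B → ∃ λ e → Positive e × e ℚ.* B ≡ ε
divide-pos ε B B>0 =
  ε ℚ.* ℚ.1/ B , ℚ.pos*pos⇒pos ε (ℚ.1/ B) {{ℚ.1/pos⇒pos B {{B>0}}}} ,
  trans (ℚ.*-assoc ε (ℚ.1/ B) B) (trans (cong (ε ℚ.*_) (ℚ.*-inverseˡ B)) (ℚ.*-identityʳ ε))
  where
  instance
    _ : ℚ.NonZero B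
    _ = ℚ.pos⇒nonZero B {{B>0}}

-- Multiplication by z ≤ B scales the error e to at most eB; `*ℝ-monoˡ-≤` therefore asks its
-- hypothesis for error ε / B.
*-mono-≤-error : ∀ {x y z e B ε} → 0ℚ ℚ.≤ z → Positive e → z ℚ.≤ B → e ℚ.* B ≡ ε →
                 x ℚ.≤ y ℚ.+ e → x ℚ.* z ℚ.≤ y ℚ.* z ℚ.+ ε
*-mono-≤-error {x} {y} {z} {e} {B} {ε} 0≤z e>0 z≤B eB≡ε x≤y+e = begin
  x ℚ.* z              ≤⟨ ℚ.*-monoʳ-≤-nonNeg z {{ℚ.nonNegative 0≤z}} x≤y+e ⟩
  (y ℚ.+ e) ℚ.* z      ≡⟨ ℚ.*-distribʳ-+ z y e ⟩
  y ℚ.* z ℚ.+ e ℚ.* z  ≤⟨ ℚ.+-monoʳ-≤ (y ℚ.* z) (ℚ.*-monoˡ-≤-nonNeg e {{ℚ.pos⇒nonNeg e {{e>0}}}} z≤B) ⟩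
  y ℚ.* z ℚ.+ e ℚ.* B  ≡⟨ cong (y ℚ.* z ℚ.+_) eB≡ε ⟩
  y ℚ.* z ℚ.+ ε        ∎
  where open ℚ.≤-Reasoning

*ℝ-monoˡ-≤ : ∀ {x y z} → NonNegℝ z → x ≤ℝ y → x *ℝ z ≤ℝ y *ℝ z
*ℝ-monoˡ-≤ {x} {y} {z} (N , 0≤z) x≤y ε =
  let B , B>0 , L , z≤B = bounded-above z
      e , e>0 , eB≡ε = divide-pos ε B B>0
      M , h = x≤y e {{e>0}}
  in N ⊔ L ⊔ M , λ n le →
    let N⊔L≤n = m⊔n≤o⇒m≤o (N ⊔ L) M le
    in *-mono-≤-error {seq x n} {seq y n} (0≤z n (m⊔n≤o⇒m≤o N L N⊔L≤n)) e>0
         (z≤B n (m⊔n≤o⇒n≤o N L N⊔L≤n)) eB≡ε (h n (m⊔n≤o⇒n≤o (N ⊔ L) M le))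

*ℝ-comm-≤ : ∀ x y → x *ℝ y ≤ℝ y *ℝ x
*ℝ-comm-≤ x y = ≤ℝ-pointwise {x *ℝ y} {y *ℝ x} λ n → ℚ.*-comm (seq x n) (seq y n)

*ℝ-monoʳ-≤ : ∀ {x y z} → NonNegℝ z → x ≤ℝ y → z *ℝ x ≤ℝ z *ℝ y
*ℝ-monoʳ-≤ {x} {y} {z} 0≤z x≤y =
  ≤ℝ-trans {z *ℝ x} {x *ℝ z} {z *ℝ y} (*ℝ-comm-≤ z x)
    (≤ℝ-trans {x *ℝ z} {y *ℝ z} {z *ℝ y} (*ℝ-monoˡ-≤ {x} {y} {z} 0≤z x≤y) (*ℝ-comm-≤ y z))

-- Eventually z ≥ δ, so an error of εδ between the products is at most εz, and cancelling z leaves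
-- ε.
*ℝ-cancelʳ-≤ : ∀ {x y z} → 0ℝ <ℝ z → x *ℝ z ≤ℝ y *ℝ z → x ≤ℝ y
*ℝ-cancelʳ-≤ {x} {y} {z} (δ , δ>0 , N , δ≤z) xz≤yz ε =
  let instance
        _ : Positive δ
        _ = δ>0
        _ : Positive (ε ℚ.* δ)
        _ = ℚ.pos*pos⇒pos ε δ
      M , h = xz≤yz (ε ℚ.* δ)
  in N ⊔ M , λ n N⊔M≤n →
    let δ≤zₙ = subst (ℚ._≤ seq z n) (ℚ.+-identityˡ δ) (δ≤z n (m⊔n≤o⇒m≤o N M N⊔M≤n))
    in ℚ.*-cancelʳ-≤-pos (seq z n) {{ℚ.positive (ℚ.<-≤-trans (ℚ.positive⁻¹ δ) δ≤zₙ)}} (begin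
      seq x n ℚ.* seq z n
        ≤⟨ h n (m⊔n≤o⇒n≤o N M N⊔M≤n) ⟩
      seq y n ℚ.* seq z n ℚ.+ ε ℚ.* δ
        ≤⟨ ℚ.+-monoʳ-≤ (seq y n ℚ.* seq z n) (ℚ.*-monoˡ-≤-nonNeg ε {{ℚ.pos⇒nonNeg ε}} δ≤zₙ) ⟩
      seq y n ℚ.* seq z n ℚ.+ ε ℚ.* seq z n
        ≡⟨ ℚ.*-distribʳ-+ (seq z n) (seq y n) ε ⟨
      (seq y n ℚ.+ ε) ℚ.* seq z n ∎)
  where open ℚ.≤-Reasoning

ι-mono-≤ : ∀ {a b} → a ≤ b → ι a ≤ℝ ι b
ι-mono-≤ {a} {b} a≤b = ≤ℝ-eventually {ι a} {ι b} 0 λ _ _ → fromℕ-mono-≤ a≤b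

-- Naturals are 1 apart, so an error of ½ does not matter.
ι-cancel-≤ : ∀ {a b} → ι a ≤ℝ ι b → a ≤ b
ι-cancel-≤ {a} {b} ιa≤ιb = ≮⇒≥ λ b<a → ℚ.<-irrefl refl (begin-strict
  fromℕ b ℚ.+ ½    <⟨ ℚ.+-monoʳ-< (fromℕ b) {½} {1ℚ} (ℚ.*<* (ℤ.+<+ (s≤s (s≤s z≤n)))) ⟩
  fromℕ b ℚ.+ 1ℚ   ≡⟨ /-+-/ b 1 1 ⟩
  fromℕ (b + 1)  ≤⟨ fromℕ-mono-≤ (subst (_≤ a) (+-comm 1 b) b<a) ⟩
  fromℕ a          ≤⟨ proj₂ (ιa≤ιb ½) _ ≤-refl ⟩
  fromℕ b ℚ.+ ½    ∎)
  where open ℚ.≤-Reasoning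

-- Division by a positive real

-- From the index in the positivity proof on, y is at least δ, so the maximum with δ that is
-- actually inverted is y itself. Earlier terms may differ, hence the equality is only eventual.
⁻¹-inverse : ∀ y (y>0 : 0ℝ <ℝ y) → ∃ λ N → ∀ n → N ≤ n → seq (y ⁻¹[ y>0 ]) n ℚ.* seq y n ≡ 1ℚ
⁻¹-inverse y y>0@(δ , δ>0 , N , δ≤y) = N , λ n N≤n →
  let δ≤yₙ = subst (ℚ._≤ seq y n) (ℚ.+-identityˡ δ) (δ≤y n N≤n)
      t = δ ℚ.⊔ seq y n
      instance
        _ : Positive δ
        _ = δ>0
        _ : ℚ.NonZero t
        _ = ℚ.pos⇒nonZero t {{ℚ.positive (ℚ.<-≤-trans (ℚ.positive⁻¹ δ) (ℚ.p≤p⊔q δ (seq y n)))}}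
  in trans (cong (seq (y ⁻¹[ y>0 ]) n ℚ.*_) (sym (ℚ.p≤q⇒p⊔q≡q δ≤yₙ))) (ℚ.*-inverseˡ t)

/ℝ-*ℝ : ∀ x y (y>0 : 0ℝ <ℝ y) →
        ∃ λ N → ∀ n → N ≤ n → seq (x /ℝ y [ y>0 ] *ℝ y) n ≡ seq x n
/ℝ-*ℝ x y y>0 = let N , h = ⁻¹-inverse y y>0 in N , λ n N≤n →
  trans (ℚ.*-assoc (seq x n) (seq (y ⁻¹[ y>0 ]) n) (seq y n))
    (trans (cong (seq x n ℚ.*_) (h n N≤n)) (ℚ.*-identityʳ (seq x n)))

/ℝ≤⇒≤*ℝ : ∀ {x y z} (y>0 : 0ℝ <ℝ y) → x /ℝ y [ y>0 ] ≤ℝ z → x ≤ℝ z *ℝ y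
/ℝ≤⇒≤*ℝ {x} {y} {z} y>0 x/y≤z = ≤ℝ-trans {x} {x /ℝ y [ y>0 ] *ℝ y} {z *ℝ y}
  (let N , h = /ℝ-*ℝ x y y>0 in
   ≤ℝ-eventually {x} {x /ℝ y [ y>0 ] *ℝ y} N λ n N≤n → ℚ.≤-reflexive (sym (h n N≤n)))
  (*ℝ-monoˡ-≤ {x /ℝ y [ y>0 ]} {z} {y} (pos⇒nonNegℝ {y} y>0) x/y≤z)

≤*ℝ⇒/ℝ≤ : ∀ {x y z} (y>0 : 0ℝ <ℝ y) → x ≤ℝ z *ℝ y → x /ℝ y [ y>0 ] ≤ℝ z
≤*ℝ⇒/ℝ≤ {x} {y} {z} y>0 x≤zy = *ℝ-cancelʳ-≤ {x /ℝ y [ y>0 ]} {z} {y} y>0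
  (≤ℝ-trans {x /ℝ y [ y>0 ] *ℝ y} {x} {z *ℝ y}
    (let N , h = /ℝ-*ℝ x y y>0 in
     ≤ℝ-eventually {x /ℝ y [ y>0 ] *ℝ y} {x} N λ n N≤n → ℚ.≤-reflexive (h n N≤n))
    x≤zy)

-- Square roots

sq-cancel-< : ∀ {a b} → a * a < b * b → a < b
sq-cancel-< a²<b² = ≰⇒> λ b≤a → <-irrefl refl (<-≤-trans a²<b² (*-mono-≤ b≤a b≤a))

sq-cancel-≤ : ∀ {a b} → a * a ≤ b * b → a ≤ b
sq-cancel-≤ a²≤b² = ≮⇒≥ λ b<a → <-irrefl refl (<-≤-trans (*-mono-< b<a b<a) a²≤b²)

√-nonNegℝ : ∀ m → NonNegℝ (√ m)
√-nonNegℝ m = 0 , λ n _ → +/-mono-≤ 0 1 (isqrt (m * (suc n * suc n))) (suc n) z≤n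

-- Every approximant is at least 1: from (n + 1)² ≤ m(n + 1)² the integer root is at least n + 1.
√-pos : ∀ m .{{_ : NonZero m}} → 0ℝ <ℝ √ m
√-pos m@(suc m-1) = 1ℚ , _ , 0 , λ n _ → subst (ℚ._≤ seq (√ m) n) (sym (ℚ.+-identityˡ 1ℚ))
  (+/-mono-≤ 1 1 (isqrt (m * (suc n * suc n))) (suc n)
    (subst₂ _≤_ (sym (*-identityˡ (suc n))) (sym (*-identityʳ _))
      (s≤s⁻¹ (sq-cancel-< {suc n} {suc (isqrt (m * (suc n * suc n)))}
        (≤-<-trans (m≤m+n (suc n * suc n) (m-1 * (suc n * suc n)))
        (isqrt-upper (m * (suc n * suc n))))))))

-- This direction holds term by term, because the approximants round down.
√*√≤ : ∀ m → √ m *ℝ √ m ≤ℝ ι m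
√*√≤ m = ≤ℝ-eventually {√ m *ℝ √ m} {ι m} 0 λ n _ →
  let k = isqrt (m * (suc n * suc n)) in
  subst (ℚ._≤ fromℕ m) (sym (/-*-/ k (suc n) k (suc n)))
    (+/-mono-≤ (k * k) (suc n * suc n) m 1
      (subst (_≤ m * (suc n * suc n)) (sym (*-identityʳ (k * k)))
        (isqrt-lower (m * (suc n * suc n)))))

-- With k = ⌊N√m⌋ we have mN² ≤ k² + 2k and k ≤ mN, so m exceeds (k/N)² by at most 2m/N.
≤√*√ : ∀ m → ι m ≤ℝ √ m *ℝ √ m
≤√*√ m ε@(mkℚ +[1+ e ] d _) = 2 * m * suc d , λ n 2md≤n → begin
  fromℕ m
    ≤⟨ +/-mono-≤ m 1 (k n * k n + 2 * m * suc n) (suc n * suc n)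
         (subst (m * (suc n * suc n) ≤_) (sym (*-identityʳ _)) (gap n)) ⟩
  + (k n * k n + 2 * m * suc n) / (suc n * suc n)
    ≡⟨ /-+-/ (k n * k n) (2 * m * suc n) (suc n * suc n) ⟨
  + (k n * k n) / (suc n * suc n) ℚ.+ + (2 * m * suc n) / (suc n * suc n)
    ≡⟨ cong (ℚ._+ + (2 * m * suc n) / (suc n * suc n)) (/-*-/ (k n) (suc n) (k n) (suc n)) ⟨
  seq (√ m *ℝ √ m) n ℚ.+ + (2 * m * suc n) / (suc n * suc n)
    ≤⟨ ℚ.+-monoʳ-≤ (seq (√ m *ℝ √ m) n) (+/-mono-≤ (2 * m * suc n) (suc n * suc n) (suc e) (suc d) (small n 2md≤n)) ⟩
  seq (√ m *ℝ √ m) n ℚ.+ + suc e / suc d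
    ≡⟨ cong (seq (√ m *ℝ √ m) n ℚ.+_) (ℚ.↥p/↧p≡p ε) ⟩
  seq (√ m *ℝ √ m) n ℚ.+ ε ∎
  where
  open ℚ.≤-Reasoning
  k : ℕ → ℕ
  k n = isqrt (m * (suc n * suc n))
  m≤m*m : ∀ m → m ≤ m * m
  m≤m*m zero      = z≤n
  m≤m*m m@(suc _) = m≤m*n m m
  -- The crude bound √m ≤ m, from m ≤ m² for naturals.
  k≤ : ∀ n → k n ≤ m * suc n
  k≤ n = sq-cancel-≤ (≤-trans (isqrt-lower (m * (suc n * suc n)))
    (≤-trans (*-monoˡ-≤ (suc n * suc n) (m≤m*m m)) (≤-reflexive (shuffle m (suc n)))))
    where
    shuffle : ∀ a b → a * a * (b * b) ≡ a * b * (a * b)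
    shuffle = solve-∀
  gap : ∀ n → m * (suc n * suc n) ≤ k n * k n + 2 * m * suc n
  gap n = ≤-trans
    (s≤s⁻¹ (≤-trans (isqrt-upper (m * (suc n * suc n))) (≤-reflexive (square (k n)))))
    (+-monoʳ-≤ (k n * k n) (≤-trans (*-monoʳ-≤ 2 (k≤ n)) (≤-reflexive (sym (*-assoc 2 m (suc n))))))
    where
    square : ∀ k → (1 + k) * (1 + k) ≡ 1 + (k * k + 2 * k)
    square = solve-∀
  -- As ε = (e + 1)/(d + 1) is at least 1/(d + 1), indices n ≥ 2m(d + 1) bring the excess 2m/(n + 1)
  -- below ε.
  small : ∀ n → 2 * m * suc d ≤ n → 2 * m * suc n * suc d ≤ suc e * (suc n * suc n)
  small n 2md≤n = ≤-trans (≤-reflexive (shuffle (2 * m) (suc n) (suc d)))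
    (≤-trans (*-monoˡ-≤ (suc n) (m≤n⇒m≤1+n 2md≤n)) (m≤n*m (suc n * suc n) (suc e)))
    where
    shuffle : ∀ a b c → a * b * c ≡ a * c * b
    shuffle = solve-∀

-- Passing between the real hypotheses and integer inequalities

module ≤ℝ-Reasoning where
  open import Relation.Binary.Reasoning.Base.Single _≤ℝ_
    (λ {x} → ≤ℝ-refl {x}) (λ {x} {y} {z} → ≤ℝ-trans {x} {y} {z}) public

ι-*-≤ : ∀ a b → ι (a * b) ≤ℝ ι a *ℝ ι b
ι-*-≤ a b = ≤ℝ-pointwise {ι (a * b)} {ι a *ℝ ι b} λ _ → fromℕ-* a b

ι-*-≥ : ∀ a b → ι a *ℝ ι b ≤ℝ ι (a * b)
ι-*-≥ a b = ≤ℝ-pointwise {ι a *ℝ ι b} {ι (a * b)} λ _ → sym (fromℕ-* a b)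

module _ (K : ℝ) (K>0 : 0ℝ <ℝ K) (N : ℕ) where
  private
    R KKN : ℝ
    R   = √ N
    KKN = K *ℝ K *ℝ ι N
    0≤K : NonNegℝ K
    0≤K = pos⇒nonNegℝ {K} K>0
    0≤R : NonNegℝ R
    0≤R = √-nonNegℝ N
    0≤KK : NonNegℝ (K *ℝ K)
    0≤KK = *ℝ-nonNegℝ {K} {K} 0≤K 0≤K
    0≤KKN : NonNegℝ KKN
    0≤KKN = *ℝ-nonNegℝ {K *ℝ K} {ι N} 0≤KK (ι-nonNegℝ N)

  -- Removes the square roots from the first hypothesis. Both sides are nonnegative, so squaring
  -- amounts to applying the bound to one factor at a time.
  square-bound : ∀ t I → K *ℝ R *ℝ √ t ≤ℝ ι I → KKN *ℝ ι t ≤ℝ ι (I * I)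
  square-bound t I h = begin
    KKN *ℝ ι t
      ∼⟨ *ℝ-monoʳ-≤ {ι t} {√ t *ℝ √ t} {KKN} 0≤KKN (≤√*√ t) ⟩
    KKN *ℝ (√ t *ℝ √ t)
      ∼⟨ *ℝ-monoˡ-≤ {KKN} {K *ℝ K *ℝ (R *ℝ R)} {√ t *ℝ √ t} (*ℝ-nonNegℝ {√ t} {√ t} (√-nonNegℝ t) (√-nonNegℝ t))
           (*ℝ-monoʳ-≤ {ι N} {R *ℝ R} {K *ℝ K} 0≤KK (≤√*√ N)) ⟩
    K *ℝ K *ℝ (R *ℝ R) *ℝ (√ t *ℝ √ t)
      ∼⟨ ≤ℝ-pointwise {K *ℝ K *ℝ (R *ℝ R) *ℝ (√ t *ℝ √ t)} {KRT *ℝ KRT} (λ n →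
           solve 3 (λ k r t → k :* k :* (r :* r) :* (t :* t) := k :* r :* t :* (k :* r :* t)) refl
             (seq K n) (seq R n) (seq (√ t) n)) ⟩
    KRT *ℝ KRT
      ∼⟨ *ℝ-monoˡ-≤ {KRT} {ι I} {KRT} 0≤KRT h ⟩
    ι I *ℝ KRT
      ∼⟨ *ℝ-monoʳ-≤ {KRT} {ι I} {ι I} (ι-nonNegℝ I) h ⟩
    ι I *ℝ ι I
      ∼⟨ ι-*-≥ I I ⟩
    ι (I * I) ∎
    where
    open ≤ℝ-Reasoning
    KRT : ℝ
    KRT = K *ℝ R *ℝ √ t
    0≤KRT : NonNegℝ KRT
    0≤KRT = *ℝ-nonNegℝ {K *ℝ R} {√ t} (*ℝ-nonNegℝ {K} {R} 0≤K 0≤R) (√-nonNegℝ t)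

  -- Multiplying 64n ≤ sK²N by ns gives 64n · ns ≤ s · K²Nns ≤ sI²; back in the naturals, s cancels
  -- and (8n)² ≤ I² remains.
  8n≤I : ∀ n s I .{{_ : NonZero n}} .{{_ : NonZero s}} →
         KKN *ℝ ι (n * s) ≤ℝ ι (I * I) → ι (64 * n) ≤ℝ ι s *ℝ KKN → 8 * n ≤ I
  8n≤I n s I KKNns≤I² 64n≤sKKN = sq-cancel-≤ (*-cancelˡ-≤ s (begin
    s * (8 * n * (8 * n))   ≡⟨ regroup s n ⟩
    64 * n * (n * s)        ≤⟨ ι-cancel-≤ bound ⟩
    s * (I * I)             ∎))
    where
    open ≤-Reasoning
    regroup : ∀ s n → s * (8 * n * (8 * n)) ≡ 64 * n * (n * s)
    regroup = solve-∀
    bound : ι (64 * n * (n * s)) ≤ℝ ι (s * (I * I))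
    bound = begin′
      ι (64 * n * (n * s))        ∼⟨ ι-*-≤ (64 * n) (n * s) ⟩
      ι (64 * n) *ℝ ι (n * s)     ∼⟨ *ℝ-monoˡ-≤ {ι (64 * n)} {ι s *ℝ KKN} {ι (n * s)} (ι-nonNegℝ (n * s)) 64n≤sKKN ⟩
      ι s *ℝ KKN *ℝ ι (n * s)     ∼⟨ ≤ℝ-pointwise {ι s *ℝ KKN *ℝ ι (n * s)} {ι s *ℝ (KKN *ℝ ι (n * s))}
                                       (λ k → ℚ.*-assoc (fromℕ s) (seq KKN k) (fromℕ (n * s))) ⟩
      ι s *ℝ (KKN *ℝ ι (n * s))   ∼⟨ *ℝ-monoʳ-≤ {KKN *ℝ ι (n * s)} {ι (I * I)} {ι s} (ι-nonNegℝ s) KKNns≤I² ⟩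
      ι s *ℝ ι (I * I)            ∼⟨ ι-*-≥ s (I * I) ⟩
      ι (s * (I * I))             ∎′
      where open ≤ℝ-Reasoning renaming (begin_ to begin′_; _∎ to _∎′)

  -- Cancelling ns in K²N · ns ≤ I² ≤ 8ms · ns gives K²N ≤ 8ms. With R = √N and s ≤ C₁KR this reads
  -- (KR)² ≤ 8mC₁ · KR, and KR > 0 cancels.
  KR≤8C₁m : ∀ n s I m C₁ .{{_ : NonZero n}} .{{_ : NonZero s}} .{{_ : NonZero N}} →
            KKN *ℝ ι (n * s) ≤ℝ ι (I * I) → I * I ≤ 8 * n * s * s * m →
            ι s ≤ℝ C₁ *ℝ K *ℝ R → K *ℝ R ≤ℝ ι m *ℝ (ι 8 *ℝ C₁)
  KR≤8C₁m n s I m C₁ KKNns≤I² I²≤8ns²m s≤C₁KR =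
    *ℝ-cancelʳ-≤ {K *ℝ R} {ι m *ℝ (ι 8 *ℝ C₁)} {K *ℝ R} (*ℝ-pos K R K>0 (√-pos N)) (begin
      K *ℝ R *ℝ (K *ℝ R)
        ∼⟨ ≤ℝ-pointwise {K *ℝ R *ℝ (K *ℝ R)} {K *ℝ K *ℝ (R *ℝ R)} (λ n →
             solve 2 (λ k r → k :* r :* (k :* r) := k :* k :* (r :* r)) refl (seq K n) (seq R n)) ⟩
      K *ℝ K *ℝ (R *ℝ R)
        ∼⟨ *ℝ-monoʳ-≤ {R *ℝ R} {ι N} {K *ℝ K} 0≤KK (√*√≤ N) ⟩
      KKN
        ∼⟨ KKN≤8ms ⟩
      ι (8 * m) *ℝ ι s
        ∼⟨ *ℝ-monoʳ-≤ {ι s} {C₁ *ℝ K *ℝ R} {ι (8 * m)} (ι-nonNegℝ (8 * m)) s≤C₁KR ⟩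
      ι (8 * m) *ℝ (C₁ *ℝ K *ℝ R)
        ∼⟨ ≤ℝ-pointwise {ι (8 * m) *ℝ (C₁ *ℝ K *ℝ R)} {ι m *ℝ (ι 8 *ℝ C₁) *ℝ (K *ℝ R)} (λ n →
             trans (cong (ℚ._* seq (C₁ *ℝ K *ℝ R) n) (fromℕ-* 8 m))
               (solve 5 (λ e m c k r → e :* m :* (c :* k :* r) := m :* (e :* c) :* (k :* r)) refl
                 (fromℕ 8) (fromℕ m) (seq C₁ n) (seq K n) (seq R n))) ⟩
      ι m *ℝ (ι 8 *ℝ C₁) *ℝ (K *ℝ R) ∎)
    where
    open ≤ℝ-Reasoning
    regroup : ∀ n s m → 8 * n * s * s * m ≡ 8 * m * s * (n * s)
    regroup = solve-∀
    KKN≤8ms : KKN ≤ℝ ι (8 * m) *ℝ ι s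
    KKN≤8ms = *ℝ-cancelʳ-≤ {KKN} {ι (8 * m) *ℝ ι s} {ι (n * s)} (ι-pos (n * s) {{m*n≢0 n s}}) (begin
      KKN *ℝ ι (n * s)                ∼⟨ KKNns≤I² ⟩
      ι (I * I)                       ∼⟨ ι-mono-≤ I²≤8ns²m ⟩
      ι (8 * n * s * s * m)           ≡⟨ cong ι (regroup n s m) ⟩
      ι (8 * m * s * (n * s))         ∼⟨ ι-*-≤ (8 * m * s) (n * s) ⟩
      ι (8 * m * s) *ℝ ι (n * s)      ∼⟨ *ℝ-monoˡ-≤ {ι (8 * m * s)} {ι (8 * m) *ℝ ι s} {ι (n * s)}
                                           (ι-nonNegℝ (n * s)) (ι-*-≤ (8 * m) s) ⟩
      ι (8 * m) *ℝ ι s *ℝ ι (n * s)   ∎)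

-- From incidence discrepancy to the pair of spheres

module _ {q : ℕ} (F : FiniteField q) {d : ℕ} (Q : QuadraticForm F d) where
  open Spheres F Q

  -- The subtracted expected count |P||𝒮|/q is nonnegative.
  σ≤incidences : ∀ P 𝒮 → fromℚ (σ P 𝒮) ≤ℝ ι (incidences P 𝒮)
  σ≤incidences P 𝒮 = ≤ℝ-eventually {fromℚ (σ P 𝒮)} {ι (incidences P 𝒮)} 0 λ _ _ → begin
    fromℕ I ℚ.- t     ≤⟨ ℚ.+-monoʳ-≤ (fromℕ I) (ℚ.neg-antimono-≤ 0≤t) ⟩
    fromℕ I ℚ.- 0ℚ    ≡⟨ ℚ.+-identityʳ (fromℕ I) ⟩
    fromℕ I           ∎
    where
    open ℚ.≤-Reasoning
    instance
      _ : NonZero q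
      _ = FiniteField.q-nonZero F
    I = incidences P 𝒮
    t = + (length P * length 𝒮) / q
    0≤t : 0ℚ ℚ.≤ t
    0≤t = +/-mono-≤ 0 1 (length P * length 𝒮) q z≤n

proposition3p8 :
  (q : ℕ) → IsPrimePower q → ¬ (2 ∣ q) →
  (F : FiniteField q) →
  (d : ℕ) → 2 ≤ d →
  (Q : QuadraticForm F d) → QuadraticForm.Nondegenerate Q →
  let open Spheres F Q in
  (P : List Point) → Unique P → .{{_ : NonZero (length P)}} →
  (𝒮 : List Sphere) → Unique 𝒮 → .{{_ : NonZero (length 𝒮)}} →
  (K C₁ : ℝ) (K>0 : 0ℝ <ℝ K) (C₁≥1 : C₁ ≥ℝ 1ℝ) →
  let n = length P
      s = length 𝒮
      I = incidences P 𝒮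
      M = ceiling ((+ I / (2 * n)) {{2*-nonZero n}})
  in
  fromℚ (σ P 𝒮) ≥ℝ K *ℝ √ (q ^ (d ∸ 1)) *ℝ √ (n * s) →
  ι (64 * n) /ℝ (K *ℝ K *ℝ ι (q ^ (d ∸ 1)))
      [ *ℝ-pos (K *ℝ K) (ι (q ^ (d ∸ 1))) (*ℝ-pos K K K>0 K>0) (q^-pos (d ∸ 1)) ]
    ≤ℝ ι s →
  ι s ≤ℝ C₁ *ℝ K *ℝ √ (q ^ (d ∸ 1)) →
  ∃[ S₀ ] ∃[ S₁ ] ∃[ P′ ] ∃[ 𝒮′ ]
    S₀ ∈ 𝒮 × S₁ ∈ 𝒮 × Nonconcentric S₀ S₁ ×
    Unique P′ × All (λ p → p ∈ P × p ∈ˢ S₀ × p ∈ˢ S₁) P′ ×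
    Unique 𝒮′ × 𝒮′ ⊆ 𝒮 ×
    ι (length P′) ≥ℝ
      K *ℝ √ (q ^ (d ∸ 1)) /ℝ (ι 8 *ℝ C₁) [ *ℝ-pos (ι 8) C₁ (ι-pos 8) (≥1⇒pos C₁ C₁≥1) ] ×
    All (λ p → + degree 𝒮 p ℤ.≥ M) P′ ×
    All (λ S → fromℕ ∣ P′ ∩ S ∣ ℚ.≥ (M / (2 * s)) {{2*-nonZero s}} ℚ.* fromℕ (length P′)) 𝒮′ ×
    fromℕ (sum (map (λ S → ∣ P′ ∩ S ∣) 𝒮′)) ℚ.≥ (M / 2) ℚ.* fromℕ (length P′) ×
    fromℕ (length 𝒮′) ℚ.≥ M / 2
proposition3p8 q _ _ F d _ Q _ P uniqP 𝒮 uniq𝒮 K C₁ K>0 C₁≥1 σ-large 64n/KKN≤s s≤C₁KR =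
  -- The conclusions are first obtained for the natural `M` and then carried to the ceiling along
  -- `⌈⌉≡M`.
  case ⌈/⌉-spec I (2 * n) {{2*-nonZero n}} of λ
  { (M , ⌈⌉≡M , I≤M*2n , least) →
  case rich-pair F Q P uniqP 𝒮 uniq𝒮 M I≤M*2n least (8n≤I K K>0 N n s I KKNns≤I² 64n≤sKKN) of λ
  { (S₀ , S₁ , P′ , 𝒮′ , S₀∈𝒮 , S₁∈𝒮 , S₀≁S₁ , uniqP′ , P′⊆ , uniq𝒮′ , 𝒮′⊆𝒮 ,
     I²≤8ns²m , M≤degree , popular , Mm≤2∑ , M≤2∣𝒮′∣) →
    S₀ , S₁ , P′ , 𝒮′ , S₀∈𝒮 , S₁∈𝒮 , S₀≁S₁ , uniqP′ , P′⊆ , uniq𝒮′ , (λ {S} → 𝒮′⊆𝒮 {S}) ,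
    ≤*ℝ⇒/ℝ≤ {K *ℝ √ N} {ι 8 *ℝ C₁} {ι (length P′)} (*ℝ-pos (ι 8) C₁ (ι-pos 8) (≥1⇒pos C₁ C₁≥1))
      (KR≤8C₁m K K>0 N n s I (length P′) C₁ KKNns≤I² I²≤8ns²m s≤C₁KR) ,
    All.map (λ {p} M≤d → subst (ℤ._≤ + degree 𝒮 p) (sym ⌈⌉≡M) (ℤ.+≤+ M≤d)) M≤degree ,
    All.map (λ {S} h → subst (λ c → (c / (2 * s)) {{2*-nonZero s}} ℚ.* fromℕ (length P′) ℚ.≤ fromℕ ∣ P′ ∩ S ∣) (sym ⌈⌉≡M)
      (/-*-fromℕ-≤ M (2 * s) (length P′) ∣ P′ ∩ S ∣ {{2*-nonZero s}} h)) popular ,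
    subst (λ c → (c / 2) ℚ.* fromℕ (length P′) ℚ.≤ fromℕ (sum (map (λ S → ∣ P′ ∩ S ∣) 𝒮′))) (sym ⌈⌉≡M)
      (/-*-fromℕ-≤ M 2 (length P′) (sum (map (λ S → ∣ P′ ∩ S ∣) 𝒮′))
        (subst (M * length P′ ≤_) (*-comm 2 (sum (map (λ S → ∣ P′ ∩ S ∣) 𝒮′))) Mm≤2∑)) ,
    subst (λ c → c / 2 ℚ.≤ fromℕ (length 𝒮′)) (sym ⌈⌉≡M)
      (+/-mono-≤ M 2 (length 𝒮′) 1 (subst₂ _≤_ (sym (*-identityʳ M)) (*-comm 2 (length 𝒮′)) M≤2∣𝒮′∣)) } }
  where
  open Spheres F Q
  n = length P
  s = length 𝒮
  I = incidences P 𝒮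
  N = q ^ (d ∸ 1)
  instance
    N-nonZero : NonZero N
    N-nonZero = m^n≢0 q (d ∸ 1) {{FiniteField.q-nonZero F}}
  -- The first hypothesis, weakened from σ to I and squared.
  KKNns≤I² : K *ℝ K *ℝ ι N *ℝ ι (n * s) ≤ℝ ι (I * I)
  KKNns≤I² = square-bound K K>0 N (n * s) I
    (≤ℝ-trans {K *ℝ √ N *ℝ √ (n * s)} {fromℚ (σ P 𝒮)} {ι I} σ-large (σ≤incidences F Q P 𝒮))
  -- The lower bound on s, with the denominator K²N cleared.
  64n≤sKKN : ι (64 * n) ≤ℝ ι s *ℝ (K *ℝ K *ℝ ι N)
  64n≤sKKN = /ℝ≤⇒≤*ℝ {ι (64 * n)} {K *ℝ K *ℝ ι N} {ι s}
    (*ℝ-pos (K *ℝ K) (ι N) (*ℝ-pos K K K>0 K>0) (q^-pos (d ∸ 1))) 64n/KKN≤s
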